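{- Let $G$ be a forest with $n$ vertices and $m$ edges, and write its Laplacian polynomial as $\psi(G,x)=\det(xI_n-L(G))=\sum_{k=0}^{n}(-1)^{n-k}c_k x^k$. Then $c_{n-6}(G)=\frac{1}{6!}\Big[64m^6-480m^5+720m^4+600m^3-360m^2-480m-720M_1^5-2160\alpha_{1,2}-720\alpha_{1,3}+540(M_1^2)^2-2340m^2M_1^2+2160mM_1^3-1080M_1^4+720M_2^1-240M_1^2M_1^3m-120M_1^6-720M_2^2+600M_1^2M_1^3+1680M_1^2m^3-810(M_1^2)^2m-1920M_1^3m^2+1620M_1^4m+3600M_2^1m-720\Theta_2-1260mM_1^2+720M_1^2+480M_1^3-240m^4M_1^2+320m^3M_1^3+360M_1^2M_2^1+90M_1^2M_1^4+180(M_1^2)^2m^2-360M_1^4m^2-1440M_2^1m^2+288M_1^5m+1440\alpha_{1,2}m+40(M_1^3)^2-15(M_1^2)^3\Big]$, where all invariants are evaluated at $G$.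
   Context: $L(G)=D(G)-A(G)$ is the Laplacian matrix (degree diagonal matrix minus adjacency matrix). For a vertex $v$, $\deg(v)$ is its degree. For real $\alpha$, $M_1^\alpha(G)=\sum_{v\in V(G)}\deg(v)^\alpha$; for real $\lambda$, $M_2^\lambda(G)=\sum_{uv\in E(G)}(\deg(u)\deg(v))^\lambda$; for reals $\lambda,\xi$, $\alpha_{\lambda,\xi}(G)=\sum_{uv\in E(G)}[\deg(u)^\lambda\deg(v)^\xi+\deg(u)^\xi\deg(v)^\lambda]$. $\Theta_2(G)=\sum \deg(u)\deg(w)$, the sum over all subgraphs of $G$ isomorphic to the path $P_3$ (each counted once), written $uvw$ with middle vertex $v$ and end vertices $u,w$. Products such as $M_1^2M_1^3$ or $(M_1^2)^2$ denote ordinary products of the numerical invariants. -}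

module Defs where

open import Data.Nat as ℕ using (ℕ; zero; suc)
open import Data.Integer as ℤ using (ℤ; +_; -_; _+_; _*_; _^_)
open import Data.Fin using (Fin; zero; suc; toℕ; punchIn; _≟_)
open import Data.Bool using (Bool; true; false; if_then_else_)
open import Data.List using (List; []; _∷_; length; zipWith)
open import Data.List.Relation.Unary.Unique.Propositional using (Unique)
open import Data.Product using (Σ; _×_; _,_)
open import Relation.Binary.PropositionalEquality using (_≡_)
open import Relation.Nullary using (¬_; does)

record SimpleGraph (n : ℕ) : Set where
  field
    adj     : Fin n → Fin n → Bool
    symm    : ∀ i j → adj i j ≡ adj j i
    irrefl  : ∀ i → adj i i ≡ false
open SimpleGraph public

Adj : ∀ {n} → SimpleGraph n → Fin n → Fin n → Set
Adj G i j = adj G i j ≡ true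

data Path {n} (G : SimpleGraph n) : Fin n → List (Fin n) → Fin n → Set where
  single : ∀ v → Path G v (v ∷ []) v
  step   : ∀ {u v w vs} → Adj G u v → Path G v vs w → Path G u (u ∷ vs) w

IsCycle : ∀ {n} → SimpleGraph n → List (Fin n) → Set
IsCycle G vs = Σ (Fin _) λ u → Σ (Fin _) λ w →
  Path G u vs w × Adj G w u × Unique vs × (3 ℕ.≤ length vs)

IsForest : ∀ {n} → SimpleGraph n → Set
IsForest G = ∀ vs → ¬ IsCycle G vs

Σℤ : ∀ {n} → (Fin n → ℤ) → ℤ
Σℤ {zero}  f = + 0
Σℤ {suc n} f = f zero + Σℤ (λ i → f (suc i))

b2z : Bool → ℤ
b2z true  = + 1
b2z false = + 0

-- sum over unordered pairs {i,j}, i ≠ j (encoded as toℕ i < toℕ j)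
Σpairs : ∀ {n} → (Fin n → Fin n → ℤ) → ℤ
Σpairs f = Σℤ λ i → Σℤ λ j → b2z (does (suc (toℕ i) ℕ.≤? toℕ j)) * f i j

deg : ∀ {n} → SimpleGraph n → Fin n → ℤ
deg G i = Σℤ λ j → b2z (adj G i j)

Σedges : ∀ {n} → SimpleGraph n → (Fin n → Fin n → ℤ) → ℤ
Σedges G f = Σpairs λ i j → b2z (adj G i j) * f i j

numEdges : ∀ {n} → SimpleGraph n → ℤ
numEdges G = Σedges G λ _ _ → + 1

M1 : ∀ {n} → ℕ → SimpleGraph n → ℤ
M1 α G = Σℤ λ v → deg G v ^ α

M2 : ∀ {n} → ℕ → SimpleGraph n → ℤ
M2 λ' G = Σedges G λ u v → (deg G u * deg G v) ^ λ'

alpha : ∀ {n} → ℕ → ℕ → SimpleGraph n → ℤ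
alpha λ' ξ G = Σedges G λ u v →
  deg G u ^ λ' * deg G v ^ ξ + deg G u ^ ξ * deg G v ^ λ'

-- Θ₂: sum over P₃ subgraphs uvw (middle v) of deg u · deg w
Theta2 : ∀ {n} → SimpleGraph n → ℤ
Theta2 G = Σℤ λ v → Σpairs λ u w →
  b2z (adj G v u) * b2z (adj G v w) * (deg G u * deg G w)

-- Polynomials over ℤ as coefficient lists (constant term first)

Poly : Set
Poly = List ℤ

_⊕_ : Poly → Poly → Poly
[] ⊕ q = q
p ⊕ [] = p
(a ∷ p) ⊕ (b ∷ q) = (a + b) ∷ (p ⊕ q)

scale : ℤ → Poly → Poly
scale c []      = []
scale c (a ∷ p) = (c * a) ∷ scale c p

_⊗_ : Poly → Poly → Poly
[] ⊗ q = []
(a ∷ p) ⊗ q = scale a q ⊕ (+ 0 ∷ (p ⊗ q))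

coeff : Poly → ℕ → ℤ
coeff []      _       = + 0
coeff (a ∷ p) zero    = a
coeff (a ∷ p) (suc k) = coeff p k

sign : ℕ → ℤ
sign k = (- (+ 1)) ^ k

ΣP : ∀ {n} → (Fin n → Poly) → Poly
ΣP {zero}  f = []
ΣP {suc n} f = f zero ⊕ ΣP (λ i → f (suc i))

det : ∀ {n} → (Fin n → Fin n → Poly) → Poly
det {zero}  M = + 1 ∷ []
det {suc n} M = ΣP λ j →
  scale (sign (toℕ j)) (M zero j ⊗ det (λ r c → M (suc r) (punchIn j c)))

laplacian : ∀ {n} → SimpleGraph n → Fin n → Fin n → ℤ
laplacian G i j with does (i ≟ j)
... | true  = deg G i
... | false = - b2z (adj G i j)

xI-L : ∀ {n} → SimpleGraph n → Fin n → Fin n → Poly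
xI-L G i j with does (i ≟ j)
... | true  = (- laplacian G i j) ∷ + 1 ∷ []
... | false = (- laplacian G i j) ∷ []

lapPoly : ∀ {n} → SimpleGraph n → Poly
lapPoly G = det (xI-L G)

-- ψ(G,x) = Σ_k (-1)^{n-k} c_k x^k
lapCoeff : ∀ {n} → SimpleGraph n → ℕ → ℤ
lapCoeff {n} G k = sign (n ℕ.∸ k) * coeff (lapPoly G) k

{-# OPTIONS --safe #-}

-- Write L = D - A for the Laplacian, c_k for the coefficients of det(I - t L) and p_s = tr(L^s).
-- Differentiating the determinant row by row and applying Cramer's rule to the resulting rows gives
-- Newton's identities k c_k + p_1 c_{k-1} + ... + p_k = 0, so 720 c_6 is a polynomial in p_1, ..., p_6.
-- Since L is symmetric, these traces are sums over pairs (i , j) of products of entries of L, L² and L³,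
-- which are combinations of entries of I, A, A², A D A and A³. In a forest at most one path joins two
-- vertices, so the value of each of these at (i , j) is determined by the distance of i and j up to
-- distance 3, and the products become linear in them; their sums are degree invariants of the forest.
module Submission where

open import Defs
open import Data.Bool using (true; false)
import Data.Bool.Properties as Bool
open import Data.Empty using (⊥; ⊥-elim)
open import Data.Fin using (Fin; zero; suc; toℕ; punchIn; _≟_)
open import Data.Fin.Properties using (any?; suc-injective)
open import Data.Integer using (ℤ; +_; -_; _+_; _-_; _*_; _^_)
import Data.Integer.Properties as ℤₚ
open import Data.Integer.Tactic.RingSolver using (solve-∀; solve)
open import Data.List using ([]; _∷_)
open import Data.List.Relation.Unary.All using () renaming ([] to []ₐ; _∷_ to _∷ₐ_)
open import Data.List.Relation.Unary.AllPairs using () renaming ([] to []ₚ; _∷_ to _∷ₚ_)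
open import Data.Nat as ℕ using (ℕ; zero; suc; z≤n; s≤s; _≤_; _∸_)
import Data.Nat.Properties as ℕₚ
open import Data.Product using (_×_; _,_; proj₁; proj₂)
open import Data.Vec.Functional using (updateAt)
open import Data.Vec.Functional.Properties using (updateAt-updates; updateAt-minimal)
open import Function using (_∘_; const)
open import Relation.Binary.PropositionalEquality hiding ([_])
open import Relation.Nullary using (¬_; ¬?; Dec; yes; no; does; contradiction; _×-dec_)
open ≡-Reasoning

-- Finite sums

-- The position of c_{n-6} in det(x I - L) depends on n. Read backwards, the polynomial becomes
-- det(I - t L), where the wanted coefficient always has index 6 and the identities relating
-- coefficients to traces do not mention n. Counting closed walks of length 6 directly would need a
-- long enumeration of shapes. Writing p_6 as the sum of the squared entries of L³, and p_5 as the
-- sum of products of entries of L² and L³, leaves only walks of length at most 3 between two given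
-- vertices. Two different paths of length at most 3 with the same ends would create a cycle of
-- length 3, 4, 5 or 6, and these are the cycles that the forest hypothesis is applied to.

Σ-cong : ∀ {n} {f g : Fin n → ℤ} → (∀ i → f i ≡ g i) → Σℤ f ≡ Σℤ g
Σ-cong {zero}  h = refl
Σ-cong {suc n} h = cong₂ _+_ (h zero) (Σ-cong (h ∘ suc))

Σ-cong₂ : ∀ {n m} {f g : Fin n → Fin m → ℤ} → (∀ i j → f i j ≡ g i j) →
  Σℤ (λ i → Σℤ (f i)) ≡ Σℤ (λ i → Σℤ (g i))
Σ-cong₂ h = Σ-cong (λ i → Σ-cong (h i))

Σ-zero : ∀ {n} {f : Fin n → ℤ} → (∀ i → f i ≡ + 0) → Σℤ f ≡ + 0
Σ-zero {zero}  h = refl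
Σ-zero {suc n} h = cong₂ _+_ (h zero) (Σ-zero (h ∘ suc))

+-congˡ : ∀ a {b c : ℤ} → b ≡ c → a + b ≡ a + c
+-congˡ a = cong (λ z → a + z)

*-congˡ : ∀ a {b c : ℤ} → b ≡ c → a * b ≡ a * c
*-congˡ a = cong (λ z → a * z)

*-congʳ : ∀ a {b c : ℤ} → b ≡ c → b * a ≡ c * a
*-congʳ a = cong (λ z → z * a)

interchange : ∀ a b c d → (a + b) + (c + d) ≡ (a + c) + (b + d)
interchange = solve-∀

Σ-+ : ∀ {n} (f g : Fin n → ℤ) → Σℤ (λ i → f i + g i) ≡ Σℤ f + Σℤ g
Σ-+ {zero}  f g = refl
Σ-+ {suc n} f g = trans (+-congˡ (f zero + g zero) (Σ-+ (f ∘ suc) (g ∘ suc)))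
                        (interchange (f zero) (g zero) (Σℤ (f ∘ suc)) (Σℤ (g ∘ suc)))

Σ-*ˡ : ∀ {n} c (f : Fin n → ℤ) → Σℤ (λ i → c * f i) ≡ c * Σℤ f
Σ-*ˡ {zero}  c f = sym (ℤₚ.*-zeroʳ c)
Σ-*ˡ {suc n} c f = trans (+-congˡ (c * f zero) (Σ-*ˡ c (f ∘ suc)))
                         (sym (ℤₚ.*-distribˡ-+ c (f zero) (Σℤ (f ∘ suc))))

Σ-*ʳ : ∀ {n} c (f : Fin n → ℤ) → Σℤ (λ i → f i * c) ≡ Σℤ f * c
Σ-*ʳ c f = trans (Σ-cong λ i → ℤₚ.*-comm (f i) c) (trans (Σ-*ˡ c f) (ℤₚ.*-comm c (Σℤ f)))

Σ-neg : ∀ {n} (f : Fin n → ℤ) → Σℤ (λ i → - f i) ≡ - Σℤ f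
Σ-neg f = trans (Σ-cong λ i → sym (ℤₚ.-1*i≡-i (f i))) (trans (Σ-*ˡ (- (+ 1)) f) (ℤₚ.-1*i≡-i (Σℤ f)))

Σ-- : ∀ {n} (f g : Fin n → ℤ) → Σℤ (λ i → f i - g i) ≡ Σℤ f - Σℤ g
Σ-- f g = trans (Σ-+ f (λ i → - g i)) (+-congˡ (Σℤ f) (Σ-neg g))

Σ-swap : ∀ {n m} (f : Fin n → Fin m → ℤ) →
  Σℤ (λ i → Σℤ (λ j → f i j)) ≡ Σℤ (λ j → Σℤ (λ i → f i j))
Σ-swap {zero} {m} f = sym (Σ-zero {m} λ _ → refl)
Σ-swap {suc n} f = trans (+-congˡ (Σℤ (f zero)) (Σ-swap (f ∘ suc)))
                         (sym (Σ-+ (f zero) (λ j → Σℤ (λ i → f (suc i) j))))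

δ : ∀ {n} → Fin n → Fin n → ℤ
δ i j = b2z (does (i ≟ j))

δ-refl : ∀ {n} (i : Fin n) → δ i i ≡ + 1
δ-refl i with i ≟ i
... | yes _ = refl
... | no ¬p = contradiction refl ¬p

δ-≢ : ∀ {n} {i j : Fin n} → i ≢ j → δ i j ≡ + 0
δ-≢ {i = i} {j} h with i ≟ j
... | yes p = contradiction p h
... | no _  = refl

δ-sym : ∀ {n} (i j : Fin n) → δ i j ≡ δ j i
δ-sym i j with i ≟ j
... | yes refl = sym (δ-refl i)
... | no ¬p    = sym (δ-≢ (¬p ∘ sym))

Σ-at : ∀ {n} (i : Fin n) (f : Fin n → ℤ) → (∀ k → k ≢ i → f k ≡ + 0) → Σℤ f ≡ f i
Σ-at zero    f h = trans (+-congˡ (f zero) (Σ-zero λ k → h (suc k) λ ())) (ℤₚ.+-identityʳ (f zero))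
Σ-at (suc i) f h = trans (cong₂ _+_ (h zero λ ()) (Σ-at i (f ∘ suc) λ k k≢i → h (suc k) λ { refl → k≢i refl }))
                         (ℤₚ.+-identityˡ (f (suc i)))

Σ-δˡ : ∀ {n} (i : Fin n) (f : Fin n → ℤ) → Σℤ (λ k → δ i k * f k) ≡ f i
Σ-δˡ i f = trans (Σ-at i _ λ k k≢i → cong (_* f k) (δ-≢ (k≢i ∘ sym)))
                 (trans (cong (_* f i) (δ-refl i)) (ℤₚ.*-identityˡ (f i)))

Σ-δʳ : ∀ {n} (i : Fin n) (f : Fin n → ℤ) → Σℤ (λ k → f k * δ k i) ≡ f i
Σ-δʳ i f = trans (Σ-cong λ k → trans (ℤₚ.*-comm (f k) (δ k i)) (cong (_* f k) (δ-sym k i))) (Σ-δˡ i f)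

ascending : ∀ {n} → Fin n → Fin n → ℤ
ascending i j = b2z (does (suc (toℕ i) ℕ.≤? toℕ j))

-- Cuts a sum over ordered pairs into the two triangles and the diagonal. The last clause needs no
-- rewriting because both decision procedures compute on successors.
ascending-trichotomy : ∀ {n} (i j : Fin n) → ascending i j + ascending j i + δ i j ≡ + 1
ascending-trichotomy zero    zero    = refl
ascending-trichotomy zero    (suc j) = refl
ascending-trichotomy (suc i) zero    = refl
ascending-trichotomy (suc i) (suc j) = ascending-trichotomy i j

-- Determinants with entries linear in t

-- Power series rather than coefficient lists: lists for the same polynomial can differ by trailing
-- zeros, whereas sequences are compared index by index.
Seq : Set
Seq = ℕ → ℤ

shift : Seq → Seq
shift P zero    = + 0
shift P (suc k) = P k

-- (b , a) stands for the linear polynomial b + a t, acting on power series in t.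
Entry : Set
Entry = ℤ × ℤ

infixr 7 _•_
_•_ : Entry → Seq → Seq
((b , a) • P) k = b * P k + a * shift P k

Mat : ℕ → Set
Mat n = Fin n → Fin n → Entry

minor : ∀ {n} → Fin (suc n) → Mat (suc n) → Mat n
minor j M r c = M (suc r) (punchIn j c)

sgn : ∀ {n} → Fin n → ℤ
sgn j = sign (toℕ j)

one : Seq
one zero    = + 1
one (suc _) = + 0

-- The expansion along the first row copies that of `det`, so that one induction can compare the two
-- in `det-reversal`.
detₜ : ∀ {n} → Mat n → Seq
detₜ {zero}  M = one
detₜ {suc n} M k = Σℤ λ j → sgn j * (M zero j • detₜ (minor j M)) k

shift-cong : ∀ {P Q : Seq} → (∀ k → P k ≡ Q k) → ∀ k → shift P k ≡ shift Q k
shift-cong h zero    = refl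
shift-cong h (suc k) = h k

•-cong : ∀ {e e′} {P Q : Seq} → e ≡ e′ → (∀ k → P k ≡ Q k) → ∀ k → (e • P) k ≡ (e′ • Q) k
•-cong {b , a} refl h k = cong₂ (λ x y → b * x + a * y) (h k) (shift-cong h k)

detₜ-cong : ∀ {n} {M N : Mat n} → (∀ r c → M r c ≡ N r c) → ∀ k → detₜ M k ≡ detₜ N k
detₜ-cong {zero}  h k = refl
detₜ-cong {suc n} h k = Σ-cong λ j → *-congˡ (sgn j)
  (•-cong (h zero j) (detₜ-cong λ r c → h (suc r) (punchIn j c)) k)

shift-Σ : ∀ {m} (P : Fin m → Seq) k → shift (λ l → Σℤ λ i → P i l) k ≡ Σℤ λ i → shift (P i) k
shift-Σ {m} P zero = sym (Σ-zero {m} λ _ → refl)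
shift-Σ P (suc k) = refl

shift-scale : ∀ c (P : Seq) k → shift (λ l → c * P l) k ≡ c * shift P k
shift-scale c P zero    = sym (ℤₚ.*-zeroʳ c)
shift-scale c P (suc k) = refl

•-Σ : ∀ {m} e (P : Fin m → Seq) k → (e • (λ l → Σℤ λ i → P i l)) k ≡ Σℤ λ i → (e • P i) k
•-Σ (b , a) P k = begin
  b * Σℤ (λ i → P i k) + a * shift (λ l → Σℤ λ i → P i l) k
    ≡⟨ +-congˡ (b * Σℤ (λ i → P i k)) (*-congˡ a (shift-Σ P k)) ⟩
  b * Σℤ (λ i → P i k) + a * Σℤ (λ i → shift (P i) k)
    ≡⟨ cong₂ _+_ (Σ-*ˡ b (λ i → P i k)) (Σ-*ˡ a (λ i → shift (P i) k)) ⟨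
  Σℤ (λ i → b * P i k) + Σℤ (λ i → a * shift (P i) k)
    ≡⟨ Σ-+ (λ i → b * P i k) (λ i → a * shift (P i) k) ⟨
  Σℤ (λ i → b * P i k + a * shift (P i) k) ∎

•-scale : ∀ e c (P : Seq) k → (e • (λ l → c * P l)) k ≡ c * (e • P) k
•-scale (b , a) c P k = trans (+-congˡ (b * (c * P k)) (*-congˡ a (shift-scale c P k)))
                              (rearrange b a c (P k) (shift P k))
  where
  rearrange : ∀ b a c x y → b * (c * x) + a * (c * y) ≡ c * (b * x + a * y)
  rearrange = solve-∀

•-lincomb : ∀ {m} e (c : Fin m → ℤ) (P : Fin m → Seq) k →
  (e • (λ l → Σℤ λ i → c i * P i l)) k ≡ Σℤ λ i → c i * (e • P i) k
•-lincomb e c P k = trans (•-Σ e (λ i l → c i * P i l) k) (Σ-cong λ i → •-scale e (c i) (P i) k)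

lincomb-• : ∀ {m} e (c : Fin m → ℤ) (E : Fin m → Entry) (P : Seq) k →
  proj₁ e ≡ Σℤ (λ i → c i * proj₁ (E i)) → proj₂ e ≡ Σℤ (λ i → c i * proj₂ (E i)) →
  (e • P) k ≡ Σℤ λ i → c i * (E i • P) k
lincomb-• (b , a) c E P k refl refl = begin
  Σℤ (λ i → c i * proj₁ (E i)) * P k + Σℤ (λ i → c i * proj₂ (E i)) * shift P k
    ≡⟨ cong₂ _+_ (Σ-*ʳ (P k) (λ i → c i * proj₁ (E i))) (Σ-*ʳ (shift P k) (λ i → c i * proj₂ (E i))) ⟨
  Σℤ (λ i → c i * proj₁ (E i) * P k) + Σℤ (λ i → c i * proj₂ (E i) * shift P k)
    ≡⟨ Σ-+ (λ i → c i * proj₁ (E i) * P k) (λ i → c i * proj₂ (E i) * shift P k) ⟨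
  Σℤ (λ i → c i * proj₁ (E i) * P k + c i * proj₂ (E i) * shift P k)
    ≡⟨ Σ-cong (λ i → factor (c i) (proj₁ (E i)) (proj₂ (E i)) (P k) (shift P k)) ⟩
  Σℤ (λ i → c i * (E i • P) k) ∎
  where
  factor : ∀ c b a x y → c * b * x + c * a * y ≡ c * (b * x + a * y)
  factor = solve-∀

•-comm : ∀ e f (P : Seq) k → (e • f • P) k ≡ (f • e • P) k
•-comm (b , a) (d , c) P zero = lemma b a d c (P zero)
  where
  lemma : ∀ b a d c x → b * (d * x + c * + 0) + a * + 0 ≡ d * (b * x + a * + 0) + c * + 0
  lemma = solve-∀
•-comm (b , a) (d , c) P (suc k) = lemma b a d c (P (suc k)) (P k) (shift P k)
  where
  lemma : ∀ b a d c x y z → b * (d * x + c * y) + a * (d * y + c * z) ≡ d * (b * x + a * y) + c * (b * y + a * z)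
  lemma = solve-∀

Σ-exchange : ∀ {m n} (c : Fin m → ℤ) (s : Fin n → ℤ) (X : Fin m → Fin n → ℤ) →
  Σℤ (λ j → s j * Σℤ (λ l → c l * X l j)) ≡ Σℤ (λ l → c l * Σℤ (λ j → s j * X l j))
Σ-exchange c s X = begin
  Σℤ (λ j → s j * Σℤ (λ l → c l * X l j))
    ≡⟨ Σ-cong (λ j → sym (Σ-*ˡ (s j) (λ l → c l * X l j))) ⟩
  Σℤ (λ j → Σℤ (λ l → s j * (c l * X l j)))
    ≡⟨ Σ-cong₂ (λ j l → lemma (s j) (c l) (X l j)) ⟩
  Σℤ (λ j → Σℤ (λ l → c l * (s j * X l j)))
    ≡⟨ Σ-swap (λ j l → c l * (s j * X l j)) ⟩
  Σℤ (λ l → Σℤ (λ j → c l * (s j * X l j)))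
    ≡⟨ Σ-cong (λ l → Σ-*ˡ (c l) (λ j → s j * X l j)) ⟩
  Σℤ (λ l → c l * Σℤ (λ j → s j * X l j)) ∎
  where
  lemma : ∀ a b c → a * (b * c) ≡ b * (a * c)
  lemma = solve-∀

-- If row `i` is the first one, its entries are combined and the minors agree (`lincomb-•`);
-- otherwise the entry is common and the minors are combined by induction (`•-lincomb`).
detₜ-linear : ∀ {n m} (i : Fin n) (c : Fin m → ℤ) (M : Mat n) (N : Fin m → Mat n) →
  (∀ l r → r ≢ i → ∀ s → N l r s ≡ M r s) →
  (∀ s → proj₁ (M i s) ≡ Σℤ λ l → c l * proj₁ (N l i s)) →
  (∀ s → proj₂ (M i s) ≡ Σℤ λ l → c l * proj₂ (N l i s)) →
  ∀ k → detₜ M k ≡ Σℤ λ l → c l * detₜ (N l) k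
detₜ-linear zero c M N off on₁ on₂ k = trans
  (Σ-cong λ j → *-congˡ (sgn j) (trans
    (lincomb-• (M zero j) c (λ l → N l zero j) (detₜ (minor j M)) k (on₁ j) (on₂ j))
    (Σ-cong λ l → *-congˡ (c l) (•-cong {N l zero j} refl
      (detₜ-cong λ r s → sym (off l (suc r) (λ ()) (punchIn j s))) k))))
  (Σ-exchange c sgn (λ l j → (N l zero j • detₜ (minor j (N l))) k))
detₜ-linear (suc i) c M N off on₁ on₂ k = trans
  (Σ-cong λ j → *-congˡ (sgn j) (trans
    (•-cong {M zero j} refl (detₜ-linear i c (minor j M) (λ l → minor j (N l))
      (λ l r r≢i s → off l (suc r) (r≢i ∘ suc-injective) (punchIn j s))
      (λ s → on₁ (punchIn j s)) (λ s → on₂ (punchIn j s))) k)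
    (trans (•-lincomb (M zero j) c (λ l → detₜ (minor j (N l))) k)
      (Σ-cong λ l → *-congˡ (c l) (•-cong {P = detₜ (minor j (N l))} (sym (off l zero (λ ()) j)) (λ _ → refl) k)))))
  (Σ-exchange c sgn (λ l j → (N l zero j • detₜ (minor j (N l))) k))

shift-•₀ : ∀ v (P : Seq) k → ((+ 0 , v) • P) k ≡ shift ((v , + 0) • P) k
shift-•₀ v P zero    = lemma v (P zero)
  where
  lemma : ∀ v x → + 0 * x + v * + 0 ≡ + 0
  lemma = solve-∀
shift-•₀ v P (suc k) = lemma v (P (suc k)) (P k) (shift P k)
  where
  lemma : ∀ v x y z → + 0 * x + v * y ≡ v * y + + 0 * z
  lemma = solve-∀

•-shift : ∀ e (P : Seq) k → (e • shift P) k ≡ shift (e • P) k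
•-shift (b , a) P zero    = cong₂ _+_ (ℤₚ.*-zeroʳ b) (ℤₚ.*-zeroʳ a)
•-shift (b , a) P (suc k) = refl

-- Homogeneity for the factor t, which `detₜ-linear` cannot supply since its coefficients are
-- integers.
detₜ-shift : ∀ {n} (i : Fin n) (v : Fin n → ℤ) (M N : Mat n) →
  (∀ r → r ≢ i → ∀ s → N r s ≡ M r s) →
  (∀ s → M i s ≡ (v s , + 0)) → (∀ s → N i s ≡ (+ 0 , v s)) →
  ∀ k → detₜ N k ≡ shift (detₜ M) k
detₜ-shift {suc n} i v M N off onM onN k = begin
  Σℤ (λ j → sgn j * (N zero j • detₜ (minor j N)) k)
    ≡⟨ Σ-cong (λ j → *-congˡ (sgn j) (term i v off onM onN j k)) ⟩
  Σℤ (λ j → sgn j * shift (M zero j • detₜ (minor j M)) k)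
    ≡⟨ Σ-cong (λ j → shift-scale (sgn j) (M zero j • detₜ (minor j M)) k) ⟨
  Σℤ (λ j → shift (λ l → sgn j * (M zero j • detₜ (minor j M)) l) k)
    ≡⟨ shift-Σ (λ j l → sgn j * (M zero j • detₜ (minor j M)) l) k ⟨
  shift (detₜ M) k ∎
  where
  term : (i : Fin (suc n)) (v : Fin (suc n) → ℤ) → (∀ r → r ≢ i → ∀ s → N r s ≡ M r s) →
    (∀ s → M i s ≡ (v s , + 0)) → (∀ s → N i s ≡ (+ 0 , v s)) →
    ∀ j k → (N zero j • detₜ (minor j N)) k ≡ shift (M zero j • detₜ (minor j M)) k
  term zero v off onM onN j k = trans
    (•-cong (onN j) (detₜ-cong λ r s → off (suc r) (λ ()) (punchIn j s)) k)
    (trans (shift-•₀ (v j) (detₜ (minor j M)) k)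
      (shift-cong (•-cong {P = detₜ (minor j M)} (sym (onM j)) (λ _ → refl)) k))
  term (suc i) v off onM onN j k = trans
    (•-cong (off zero (λ ()) j)
      (detₜ-shift i (v ∘ punchIn j) (minor j M) (minor j N)
        (λ r r≢i s → off (suc r) (r≢i ∘ suc-injective) (punchIn j s))
        (onM ∘ punchIn j) (onN ∘ punchIn j)) k)
    (•-shift (M zero j) (detₜ (minor j M)) k)

-- Exchange of rows and alternation

-- If k = punchOut of j′ from j, then punchIn j k = j′ and complement j k is the punchOut of j from j′.
complement : ∀ {n} → Fin (suc n) → Fin n → Fin n
complement {suc n} zero    k       = zero
complement {suc n} (suc j) zero    = j
complement {suc n} (suc j) (suc k) = suc (complement j k)

punchIn-complement : ∀ {n} (j : Fin (suc n)) (k : Fin n) → punchIn (punchIn j k) (complement j k) ≡ j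
punchIn-complement {suc n} zero    k       = refl
punchIn-complement {suc n} (suc j) zero    = refl
punchIn-complement {suc n} (suc j) (suc k) = cong suc (punchIn-complement j k)

punchIn-punchIn : ∀ {n} (j : Fin (suc (suc n))) (k : Fin (suc n)) (c : Fin n) →
  punchIn (punchIn j k) (punchIn (complement j k) c) ≡ punchIn j (punchIn k c)
punchIn-punchIn zero    k       c       = refl
punchIn-punchIn (suc j) zero    c       = refl
punchIn-punchIn (suc j) (suc k) zero    = refl
punchIn-punchIn (suc j) (suc k) (suc c) = cong suc (punchIn-punchIn j k c)

-- Of two distinct columns, deleting the smaller lowers the index of the larger by one, while
-- deleting the larger leaves the smaller where it is. The two orders of deletion thus give
-- exponents that differ by one.
sgn-complement : ∀ {n} (j : Fin (suc n)) (k : Fin n) →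
  sgn (punchIn j k) * sgn (complement j k) ≡ - (sgn j * sgn k)
sgn-complement {suc n} zero k = lemma (sgn k)
  where
  lemma : ∀ x → (- (+ 1) * x) * + 1 ≡ - (+ 1 * x)
  lemma = solve-∀
sgn-complement {suc n} (suc j) zero = lemma (sgn j)
  where
  lemma : ∀ x → + 1 * x ≡ - ((- (+ 1) * x) * + 1)
  lemma = solve-∀
sgn-complement {suc n} (suc j) (suc k) = begin
  (- (+ 1) * sgn (punchIn j k)) * (- (+ 1) * sgn (complement j k))
    ≡⟨ cancel (sgn (punchIn j k)) (sgn (complement j k)) ⟩
  sgn (punchIn j k) * sgn (complement j k)
    ≡⟨ sgn-complement j k ⟩
  - (sgn j * sgn k)
    ≡⟨ cong -_ (cancel (sgn j) (sgn k)) ⟨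
  - ((- (+ 1) * sgn j) * (- (+ 1) * sgn k)) ∎
  where
  cancel : ∀ x y → (- (+ 1) * x) * (- (+ 1) * y) ≡ x * y
  cancel = solve-∀

-- The pair (`punchIn j k`, `complement j k`) encodes the ordered pair of distinct columns encoded
-- by (j , k), with its members exchanged, so this is a reindexing by an involution. The induction
-- splits off the pairs that contain column zero.
Σ-complement : ∀ {n} (f : Fin (suc n) → Fin n → ℤ) →
  Σℤ (λ j → Σℤ λ k → f (punchIn j k) (complement j k)) ≡ Σℤ (λ j → Σℤ λ k → f j k)
Σ-complement {zero}  f = refl
Σ-complement {suc n} f = begin
  Σℤ (λ k → f (suc k) zero)
    + Σℤ (λ j → f zero j + Σℤ (λ k → f (suc (punchIn j k)) (suc (complement j k))))
    ≡⟨ +-congˡ (Σℤ (λ k → f (suc k) zero)) (Σ-+ (f zero) (λ j → Σℤ (λ k → f (suc (punchIn j k)) (suc (complement j k))))) ⟩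
  Σℤ (λ k → f (suc k) zero)
    + (Σℤ (f zero) + Σℤ (λ j → Σℤ (λ k → f (suc (punchIn j k)) (suc (complement j k)))))
    ≡⟨ cong (λ z → Σℤ (λ k → f (suc k) zero) + (Σℤ (f zero) + z)) (Σ-complement (λ j k → f (suc j) (suc k))) ⟩
  Σℤ (λ k → f (suc k) zero) + (Σℤ (f zero) + Σℤ (λ j → Σℤ (λ k → f (suc j) (suc k))))
    ≡⟨ rotate (Σℤ (λ k → f (suc k) zero)) (Σℤ (f zero)) (Σℤ (λ j → Σℤ (λ k → f (suc j) (suc k)))) ⟩
  Σℤ (f zero) + (Σℤ (λ k → f (suc k) zero) + Σℤ (λ j → Σℤ (λ k → f (suc j) (suc k))))
    ≡⟨ +-congˡ (Σℤ (f zero)) (Σ-+ (λ k → f (suc k) zero) (λ j → Σℤ (λ k → f (suc j) (suc k)))) ⟨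
  Σℤ (f zero) + Σℤ (λ j → f (suc j) zero + Σℤ (λ k → f (suc j) (suc k))) ∎
  where
  rotate : ∀ a b c → a + (b + c) ≡ b + (a + c)
  rotate = solve-∀

swapRows : ∀ {n} → Mat (suc (suc n)) → Mat (suc (suc n))
swapRows M zero          = M (suc zero)
swapRows M (suc zero)    = M zero
swapRows M (suc (suc r)) = M (suc (suc r))

-- Expanding along the first two rows, the terms for the column pairs (j , j′) and (j′ , j)
-- are exchanged up to sign.
detₜ-swap : ∀ {n} (M : Mat (suc (suc n))) k → detₜ (swapRows M) k ≡ - detₜ M k
detₜ-swap {n} M k = begin
  detₜ (swapRows M) k
    ≡⟨ expand (swapRows M) ⟩
  Σℤ (λ j → Σℤ λ l → G (swapRows M) j l)
    ≡⟨ Σ-complement (G (swapRows M)) ⟨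
  Σℤ (λ j → Σℤ λ l → G (swapRows M) (punchIn j l) (complement j l))
    ≡⟨ Σ-cong₂ G-swap ⟩
  Σℤ (λ j → Σℤ λ l → - G M j l)
    ≡⟨ Σ-cong (λ j → Σ-neg (G M j)) ⟩
  Σℤ (λ j → - Σℤ λ l → G M j l)
    ≡⟨ Σ-neg (λ j → Σℤ λ l → G M j l) ⟩
  - Σℤ (λ j → Σℤ λ l → G M j l)
    ≡⟨ cong -_ (expand M) ⟨
  - detₜ M k ∎
  where
  G : Mat (suc (suc n)) → Fin (suc (suc n)) → Fin (suc n) → ℤ
  G M j l = sgn j * sgn l * (M zero j • M (suc zero) (punchIn j l) • detₜ (minor l (minor j M))) k

  expand : ∀ M → detₜ M k ≡ Σℤ (λ j → Σℤ λ l → G M j l)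
  expand M = Σ-cong λ j → begin
    sgn j * (M zero j • detₜ (minor j M)) k
      ≡⟨ *-congˡ (sgn j) (•-lincomb (M zero j) sgn (λ l → M (suc zero) (punchIn j l) • detₜ (minor l (minor j M))) k) ⟩
    sgn j * Σℤ (λ l → sgn l * (M zero j • M (suc zero) (punchIn j l) • detₜ (minor l (minor j M))) k)
      ≡⟨ Σ-*ˡ (sgn j) (λ l → sgn l * (M zero j • M (suc zero) (punchIn j l) • detₜ (minor l (minor j M))) k) ⟨
    Σℤ (λ l → sgn j * (sgn l * (M zero j • M (suc zero) (punchIn j l) • detₜ (minor l (minor j M))) k))
      ≡⟨ Σ-cong (λ l → ℤₚ.*-assoc (sgn j) (sgn l) ((M zero j • M (suc zero) (punchIn j l) • detₜ (minor l (minor j M))) k)) ⟨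
    Σℤ (λ l → G M j l) ∎

  G-swap : ∀ j l → G (swapRows M) (punchIn j l) (complement j l) ≡ - G M j l
  G-swap j l = begin
    sgn (punchIn j l) * sgn (complement j l)
      * (e • M zero (punchIn (punchIn j l) (complement j l)) • detₜ (minor (complement j l) (minor (punchIn j l) (swapRows M)))) k
      ≡⟨ cong₂ _*_ (sgn-complement j l)
           (•-cong {e} refl (•-cong (cong (M zero) (punchIn-complement j l))
             (detₜ-cong λ r c → cong (M (suc (suc r))) (punchIn-punchIn j l c))) k) ⟩
    - (sgn j * sgn l) * (e • M zero j • P) k
      ≡⟨ *-congˡ (- (sgn j * sgn l)) (•-comm e (M zero j) P k) ⟩
    - (sgn j * sgn l) * (M zero j • e • P) k
      ≡⟨ ℤₚ.neg-distribˡ-* (sgn j * sgn l) ((M zero j • e • P) k) ⟨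
    - (sgn j * sgn l * (M zero j • e • P) k) ∎
    where
    e = M (suc zero) (punchIn j l)
    P = detₜ (minor l (minor j M))

-- Turns antisymmetry into vanishing. For nonzero x the two sides have different constructors, so
-- one clause covers everything.
x≡-x⇒x≡0 : ∀ x → x ≡ - x → x ≡ + 0
x≡-x⇒x≡0 (+ zero) _ = refl

•-zero : ∀ e {P : Seq} → (∀ k → P k ≡ + 0) → ∀ k → (e • P) k ≡ + 0
•-zero (b , a) h zero    = cong₂ _+_ (trans (*-congˡ b (h 0)) (ℤₚ.*-zeroʳ b)) (ℤₚ.*-zeroʳ a)
•-zero (b , a) h (suc k) = cong₂ _+_ (trans (*-congˡ b (h (suc k))) (ℤₚ.*-zeroʳ b)) (trans (*-congˡ a (h k)) (ℤₚ.*-zeroʳ a))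

detₜ-zero : ∀ {n} (M : Mat (suc n)) → (∀ j k → detₜ (minor j M) k ≡ + 0) → ∀ k → detₜ M k ≡ + 0
detₜ-zero M h k = Σ-zero λ j → trans (*-congˡ (sgn j) (•-zero (M zero j) (h j) k)) (ℤₚ.*-zeroʳ (sgn j))

-- If the equal rows are the first two, exchanging them fixes the matrix but negates the
-- determinant. If the second one lies lower, exchanging the first two rows moves both equal rows
-- into every minor, where induction applies.
detₜ-alternating₀ : ∀ {n} (j : Fin n) (M : Mat (suc n)) → (∀ s → M zero s ≡ M (suc j) s) → ∀ k → detₜ M k ≡ + 0
detₜ-alternating : ∀ {n} (i j : Fin n) (M : Mat n) → i ≢ j → (∀ s → M i s ≡ M j s) → ∀ k → detₜ M k ≡ + 0

detₜ-alternating₀ zero M h k = x≡-x⇒x≡0 (detₜ M k) (trans (detₜ-cong same k) (detₜ-swap M k))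
  where
  same : ∀ r c → M r c ≡ swapRows M r c
  same zero          c = h c
  same (suc zero)    c = sym (h c)
  same (suc (suc r)) c = refl
detₜ-alternating₀ (suc j) M h k = begin
  detₜ M k                    ≡⟨ ℤₚ.neg-involutive (detₜ M k) ⟨
  - - detₜ M k                ≡⟨ cong -_ (detₜ-swap M k) ⟨
  - detₜ (swapRows M) k       ≡⟨ cong -_ (detₜ-zero (swapRows M) (λ l → detₜ-alternating₀ j (minor l (swapRows M)) (h ∘ punchIn l)) k) ⟩
  - (+ 0) ∎

detₜ-alternating zero    zero    M i≢j h k = contradiction refl i≢j
detₜ-alternating zero    (suc j) M i≢j h k = detₜ-alternating₀ j M h k
detₜ-alternating (suc i) zero    M i≢j h k = detₜ-alternating₀ i M (sym ∘ h) k
detₜ-alternating (suc i) (suc j) M i≢j h k =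
  detₜ-zero M (λ l → detₜ-alternating i j (minor l M) (i≢j ∘ cong suc) (h ∘ punchIn l)) k

-- Product rule for t d/dt on an entry times a series: the derivation sends b + a t to a t, that is,
-- to `(+ 0 , a)`.
euler-• : ∀ e (P : Seq) k → + k * (e • P) k ≡ ((+ 0 , proj₂ e) • P) k + (e • (λ l → + l * P l)) k
euler-• (b , a) P zero = lemma b a (P zero)
  where
  lemma : ∀ b a x → + 0 * (b * x + a * + 0) ≡ (+ 0 * x + a * + 0) + (b * (+ 0 * x) + a * + 0)
  lemma = solve-∀
euler-• (b , a) P (suc k) = lemma b a (P (suc k)) (P k) (+ k)
  where
  lemma : ∀ b a x y m → (+ 1 + m) * (b * x + a * y) ≡ (+ 0 * x + a * y) + (b * ((+ 1 + m) * x) + a * (m * y))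
  lemma = solve-∀

-- Leibniz rule for the derivation t d/dt, which multiplies the k-th coefficient by k.
detₜ-euler : ∀ {n} (M : Mat n) (N : Fin n → Mat n) →
  (∀ i r → r ≢ i → ∀ c → N i r c ≡ M r c) →
  (∀ i c → N i i c ≡ (+ 0 , proj₂ (M i c))) →
  ∀ k → + k * detₜ M k ≡ Σℤ λ i → detₜ (N i) k
detₜ-euler {zero} M N off on zero    = refl
detₜ-euler {zero} M N off on (suc k) = ℤₚ.*-zeroʳ (+ suc k)
detₜ-euler {suc n} M N off on k = begin
  + k * Σℤ (λ j → sgn j * (M zero j • P j) k)
    ≡⟨ Σ-*ˡ (+ k) (λ j → sgn j * (M zero j • P j) k) ⟨
  Σℤ (λ j → + k * (sgn j * (M zero j • P j) k))
    ≡⟨ Σ-cong term ⟩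
  Σℤ (λ j → sgn j * (N zero zero j • detₜ (minor j (N zero))) k + Σℤ (λ i → X i j))
    ≡⟨ Σ-+ (λ j → sgn j * (N zero zero j • detₜ (minor j (N zero))) k) (λ j → Σℤ (λ i → X i j)) ⟩
  detₜ (N zero) k + Σℤ (λ j → Σℤ (λ i → X i j))
    ≡⟨ +-congˡ (detₜ (N zero) k) (Σ-swap (λ j i → X i j)) ⟩
  Σℤ (λ i → detₜ (N i) k) ∎
  where
  P : Fin (suc n) → Seq
  P j = detₜ (minor j M)

  X : Fin n → Fin (suc n) → ℤ
  X i j = sgn j * (N (suc i) zero j • detₜ (minor j (N (suc i)))) k

  rearrange : ∀ m s x y z → m * x ≡ y + z → m * (s * x) ≡ s * y + s * z
  rearrange m s x y z h = trans (lemma m s x) (trans (*-congˡ s h) (ℤₚ.*-distribˡ-+ s y z))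
    where
    lemma : ∀ m s x → m * (s * x) ≡ s * (m * x)
    lemma = solve-∀

  term : ∀ j → + k * (sgn j * (M zero j • P j) k)
    ≡ sgn j * (N zero zero j • detₜ (minor j (N zero))) k + Σℤ (λ i → X i j)
  term j = trans (rearrange (+ k) (sgn j) ((M zero j • P j) k) _ _ (euler-• (M zero j) (P j) k))
    (cong₂ _+_
      (*-congˡ (sgn j) (•-cong (sym (on zero j)) (detₜ-cong λ r c → sym (off zero (suc r) (λ ()) (punchIn j c))) k))
      (trans (*-congˡ (sgn j) (trans
          (•-cong {M zero j} refl (detₜ-euler (minor j M) (λ i → minor j (N (suc i)))
            (λ i r r≢i c → off (suc i) (suc r) (r≢i ∘ suc-injective) (punchIn j c))
            (λ i c → on (suc i) (punchIn j c))) k)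
          (trans (•-Σ (M zero j) (λ i → detₜ (minor j (N (suc i)))) k)
            (Σ-cong λ i → •-cong {P = detₜ (minor j (N (suc i)))} (sym (off (suc i) zero (λ ()) j)) (λ _ → refl) k))))
        (sym (Σ-*ˡ (sgn j) (λ i → (N (suc i) zero j • detₜ (minor j (N (suc i)))) k)))))

detₜ-constant : ∀ {n} (M : Mat n) → (∀ r c → proj₁ (M r c) ≡ δ r c) → detₜ M 0 ≡ + 1
detₜ-constant {zero}  M h = refl
detₜ-constant {suc n} M h = begin
  Σℤ (λ j → sgn j * (M zero j • P j) 0)
    ≡⟨ Σ-cong (λ j → lemma (sgn j) (proj₁ (M zero j)) (proj₂ (M zero j)) (P j 0)) ⟩
  Σℤ (λ j → proj₁ (M zero j) * (sgn j * P j 0))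
    ≡⟨ Σ-cong (λ j → *-congʳ (sgn j * P j 0) (h zero j)) ⟩
  Σℤ (λ j → δ zero j * (sgn j * P j 0))
    ≡⟨ Σ-δˡ zero (λ j → sgn j * P j 0) ⟩
  + 1 * P zero 0
    ≡⟨ ℤₚ.*-identityˡ (P zero 0) ⟩
  P zero 0
    ≡⟨ detₜ-constant (minor zero M) (λ r c → h (suc r) (suc c)) ⟩
  + 1 ∎
  where
  P : Fin (suc n) → Seq
  P j = detₜ (minor j M)
  lemma : ∀ s b a x → s * (b * x + a * + 0) ≡ b * (s * x)
  lemma = solve-∀

-- Newton's identities

_[_≔_] : ∀ {n} → Mat n → Fin n → (Fin n → Entry) → Mat n
M [ i ≔ v ] = updateAt M i (const v)

≔-same : ∀ {n} (M : Mat n) i v s → (M [ i ≔ v ]) i s ≡ v s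
≔-same M i v s = cong-app (updateAt-updates i M) s

≔-other : ∀ {n} (M : Mat n) i v {r} → r ≢ i → ∀ s → (M [ i ≔ v ]) r s ≡ M r s
≔-other M i v {r} r≢i s = cong-app (updateAt-minimal r i M r≢i) s

≔-self : ∀ {n} (M : Mat n) i r s → (M [ i ≔ M i ]) r s ≡ M r s
≔-self M i r s with r ≟ i
... | yes refl = ≔-same M i (M i) s
... | no r≢i   = ≔-other M i (M i) r≢i s

module CharPoly {n} (L : Fin n → Fin n → ℤ) where

  I-tL : Mat n
  I-tL r s = δ r s , - L r s

  c : Seq
  c = detₜ I-tL

  pow : ℕ → Fin n → Fin n → ℤ
  pow zero    i j = δ i j
  pow (suc s) i j = Σℤ λ k → pow s i k * L k j

  trace : ℕ → ℤ
  trace s = Σℤ λ i → pow s i i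

  pow-+ : ∀ s t i j → pow (t ℕ.+ s) i j ≡ Σℤ λ k → pow s i k * pow t k j
  pow-+ s zero    i j = sym (Σ-δʳ j (pow s i))
  pow-+ s (suc t) i j = begin
    Σℤ (λ k → pow (t ℕ.+ s) i k * L k j)
      ≡⟨ Σ-cong (λ k → *-congʳ (L k j) (pow-+ s t i k)) ⟩
    Σℤ (λ k → Σℤ (λ l → pow s i l * pow t l k) * L k j)
      ≡⟨ Σ-cong (λ k → Σ-*ʳ (L k j) (λ l → pow s i l * pow t l k)) ⟨
    Σℤ (λ k → Σℤ λ l → pow s i l * pow t l k * L k j)
      ≡⟨ Σ-swap (λ k l → pow s i l * pow t l k * L k j) ⟩
    Σℤ (λ l → Σℤ λ k → pow s i l * pow t l k * L k j)
      ≡⟨ Σ-cong₂ (λ l k → ℤₚ.*-assoc (pow s i l) (pow t l k) (L k j)) ⟩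
    Σℤ (λ l → Σℤ λ k → pow s i l * (pow t l k * L k j))
      ≡⟨ Σ-cong (λ l → Σ-*ˡ (pow s i l) (λ k → pow t l k * L k j)) ⟩
    Σℤ (λ l → pow s i l * pow (suc t) l j) ∎

  pow-1 : ∀ i j → pow 1 i j ≡ L i j
  pow-1 i j = Σ-δˡ i (λ k → L k j)

  pow-sym : (∀ i j → L i j ≡ L j i) → ∀ s i j → pow s i j ≡ pow s j i
  pow-sym L-sym zero    i j = δ-sym i j
  pow-sym L-sym (suc s) i j = begin
    Σℤ (λ k → pow s i k * L k j)
      ≡⟨ Σ-cong (λ k → trans (cong₂ _*_ (pow-sym L-sym s i k) (trans (L-sym k j) (sym (pow-1 j k)))) (ℤₚ.*-comm (pow s k i) (pow 1 j k))) ⟩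
    Σℤ (λ k → pow 1 j k * pow s k i)
      ≡⟨ pow-+ 1 s j i ⟨
    pow (s ℕ.+ 1) j i
      ≡⟨ cong (λ t → pow t j i) (ℕₚ.+-comm s 1) ⟩
    pow (suc s) j i ∎

  trace-+ : (∀ i j → L i j ≡ L j i) → ∀ s t → trace (t ℕ.+ s) ≡ Σℤ λ i → Σℤ λ j → pow s i j * pow t i j
  trace-+ L-sym s t = Σ-cong λ i → trans (pow-+ s t i i) (Σ-cong λ j → *-congˡ (pow s i j) (pow-sym L-sym t j i))

  -- Entry i of the row vector v times the adjugate of I - t L, obtained without defining the
  -- adjugate.
  F : Fin n → (Fin n → ℤ) → Seq
  F i v = detₜ (I-tL [ i ≔ (λ s → v s , + 0) ])

  -- The row v - t v L is the combination of the rows of I - t L with coefficients v.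
  cramer : ∀ i v k → F i v k ≡ v i * c k + shift (F i (λ s → Σℤ λ l → v l * L l s)) k
  cramer i v k = begin
    F i v k
      -- The row v is (v - t vL) + t vL. The two summands are the i-th rows of `R` and `V`;
      -- linearity is used as R = F - V, and the trailing `+ + 0` is the end of the sum over
      -- `Fin 2`.
      ≡⟨ split (F i v k) (detₜ V k) ⟩
    (+ 1 * F i v k + (- (+ 1) * detₜ V k + + 0)) + detₜ V k
      ≡⟨ cong (_+ detₜ V k) (detₜ-linear i coef R Parts parts-off parts-on₁ parts-on₂ k) ⟨
    detₜ R k + detₜ V k
      ≡⟨ cong₂ _+_ combination (detₜ-shift i vL (I-tL [ i ≔ (λ s → vL s , + 0) ]) V
           (λ r r≢i s → trans (≔-other I-tL i _ r≢i s) (sym (≔-other I-tL i _ r≢i s)))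
           (≔-same I-tL i _) (≔-same I-tL i _) k) ⟩
    v i * c k + shift (F i vL) k ∎
    where
    vL : Fin n → ℤ
    vL s = Σℤ λ l → v l * L l s

    R V : Mat n
    R = I-tL [ i ≔ (λ s → v s , - vL s) ]
    V = I-tL [ i ≔ (λ s → + 0 , vL s) ]

    coef : Fin 2 → ℤ
    coef zero       = + 1
    coef (suc zero) = - (+ 1)

    Parts : Fin 2 → Mat n
    Parts zero       = I-tL [ i ≔ (λ s → v s , + 0) ]
    Parts (suc zero) = V

    split : ∀ x y → x ≡ (+ 1 * x + (- (+ 1) * y + + 0)) + y
    split = solve-∀

    parts-off : ∀ l r → r ≢ i → ∀ s → Parts l r s ≡ R r s
    parts-off zero       r r≢i s = trans (≔-other I-tL i _ r≢i s) (sym (≔-other I-tL i _ r≢i s))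
    parts-off (suc zero) r r≢i s = trans (≔-other I-tL i _ r≢i s) (sym (≔-other I-tL i _ r≢i s))

    parts-on₁ : ∀ s → proj₁ (R i s) ≡ Σℤ λ l → coef l * proj₁ (Parts l i s)
    parts-on₁ s = trans (cong proj₁ (≔-same I-tL i _ s)) (trans (lemma (v s))
      (sym (cong₂ (λ x y → + 1 * proj₁ x + (- (+ 1) * proj₁ y + + 0)) (≔-same I-tL i (λ s → v s , + 0) s) (≔-same I-tL i (λ s → + 0 , vL s) s))))
      where
      lemma : ∀ x → x ≡ + 1 * x + (- (+ 1) * + 0 + + 0)
      lemma = solve-∀

    parts-on₂ : ∀ s → proj₂ (R i s) ≡ Σℤ λ l → coef l * proj₂ (Parts l i s)
    parts-on₂ s = trans (cong proj₂ (≔-same I-tL i _ s)) (trans (lemma (vL s))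
      (sym (cong₂ (λ x y → + 1 * proj₂ x + (- (+ 1) * proj₂ y + + 0)) (≔-same I-tL i (λ s → v s , + 0) s) (≔-same I-tL i (λ s → + 0 , vL s) s))))
      where
      lemma : ∀ x → - x ≡ + 1 * + 0 + (- (+ 1) * x + + 0)
      lemma = solve-∀

    Rows : Fin n → Mat n
    Rows l = I-tL [ i ≔ I-tL l ]

    combination : detₜ R k ≡ v i * c k
    combination = begin
      detₜ R k
        ≡⟨ detₜ-linear i v R Rows
             (λ l r r≢i s → trans (≔-other I-tL i _ r≢i s) (sym (≔-other I-tL i _ r≢i s)))
             (λ s → trans (cong proj₁ (≔-same I-tL i _ s)) (trans (sym (Σ-δʳ s v))
               (Σ-cong λ l → *-congˡ (v l) (sym (cong proj₁ (≔-same I-tL i (I-tL l) s))))))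
             (λ s → trans (cong proj₂ (≔-same I-tL i _ s)) (trans (sym (Σ-neg (λ l → v l * L l s)))
               (Σ-cong λ l → trans (ℤₚ.neg-distribʳ-* (v l) (L l s)) (*-congˡ (v l) (sym (cong proj₂ (≔-same I-tL i (I-tL l) s)))))))
             k ⟩
      Σℤ (λ l → v l * detₜ (Rows l) k)
        -- For l different from i, row i is a copy of row l, so only the unchanged matrix
        -- contributes.
        ≡⟨ Σ-at i _ (λ l l≢i → trans (*-congˡ (v l) (detₜ-alternating i l (Rows l) (l≢i ∘ sym)
             (λ s → trans (≔-same I-tL i (I-tL l) s) (sym (≔-other I-tL i (I-tL l) l≢i s))) k)) (ℤₚ.*-zeroʳ (v l))) ⟩
      v i * detₜ (Rows i) k
        ≡⟨ *-congˡ (v i) (detₜ-cong (≔-self I-tL i) k) ⟩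
      v i * c k ∎

  -- The series tr(L^s adj(I - t L)). Summing `cramer` over the diagonal gives T_s = p_s c + t
  -- T_{s+1}; unrolling this recursion from s = 1 produces the sums in Newton's identities.
  T : ℕ → Seq
  T s k = Σℤ λ i → F i (pow s i) k

  T-rec : ∀ s k → T s k ≡ trace s * c k + shift (T (suc s)) k
  T-rec s k = begin
    Σℤ (λ i → F i (pow s i) k)
      -- For the row `pow s i`, the shifted row in `cramer` is `pow (suc s) i` by definition.
      ≡⟨ Σ-cong (λ i → cramer i (pow s i) k) ⟩
    Σℤ (λ i → pow s i i * c k + shift (F i (pow (suc s) i)) k)
      ≡⟨ Σ-+ (λ i → pow s i i * c k) (λ i → shift (F i (pow (suc s) i)) k) ⟩
    Σℤ (λ i → pow s i i * c k) + Σℤ (λ i → shift (F i (pow (suc s) i)) k)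
      ≡⟨ cong₂ _+_ (Σ-*ʳ (c k) (λ i → pow s i i)) (sym (shift-Σ (λ i → F i (pow (suc s) i)) k)) ⟩
    trace s * c k + shift (T (suc s)) k ∎

  T-zero : ∀ s → T s 0 ≡ trace s
  T-zero s = trans (T-rec s 0) (trans (cong (λ z → trace s * z + + 0) (detₜ-constant I-tL λ _ _ → refl)) (lemma (trace s)))
    where
    lemma : ∀ x → x * + 1 + + 0 ≡ x
    lemma = solve-∀

  -- Jacobi's formula t c′(t) = - t tr(L adj(I - t L)), read off in degree k + 1; the factor t
  -- accounts for the index k on the right.
  euler : ∀ k → + suc k * c (suc k) ≡ - T 1 k
  euler k = begin
    + suc k * c (suc k)
      ≡⟨ detₜ-euler I-tL (λ i → I-tL [ i ≔ (λ s → + 0 , - L i s) ])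
           (λ i r r≢i s → ≔-other I-tL i _ r≢i s) (λ i s → ≔-same I-tL i _ s) (suc k) ⟩
    Σℤ (λ i → detₜ (I-tL [ i ≔ (λ s → + 0 , - L i s) ]) (suc k))
      ≡⟨ Σ-cong (λ i → trans (negate i) (cong -_ (detₜ-shift i (pow 1 i) (I-tL [ i ≔ (λ s → pow 1 i s , + 0) ]) (V i)
           (λ r r≢i s → trans (≔-other I-tL i _ r≢i s) (sym (≔-other I-tL i _ r≢i s)))
           (≔-same I-tL i _) (≔-same I-tL i _) (suc k)))) ⟩
    Σℤ (λ i → - F i (pow 1 i) k)
      ≡⟨ Σ-neg (λ i → F i (pow 1 i) k) ⟩
    - T 1 k ∎
    where
    V : Fin n → Mat n
    V i = I-tL [ i ≔ (λ s → + 0 , pow 1 i s) ]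

    negate : ∀ i → detₜ (I-tL [ i ≔ (λ s → + 0 , - L i s) ]) (suc k) ≡ - detₜ (V i) (suc k)
    negate i = trans (detₜ-linear {m = 1} i (λ _ → - (+ 1)) _ (λ _ → V i)
        (λ l r r≢i s → trans (≔-other I-tL i _ r≢i s) (sym (≔-other I-tL i _ r≢i s)))
        (λ s → trans (cong proj₁ (≔-same I-tL i _ s)) (sym (cong (λ x → - (+ 1) * proj₁ x + + 0) (≔-same I-tL i (λ s → + 0 , pow 1 i s) s))))
        (λ s → trans (cong proj₂ (≔-same I-tL i _ s)) (trans (cong -_ (sym (pow-1 i s)))
          (trans (lemma (pow 1 i s)) (sym (cong (λ x → - (+ 1) * proj₂ x + + 0) (≔-same I-tL i (λ s → + 0 , pow 1 i s) s))))))
        (suc k))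
      (sym (lemma (detₜ (V i) (suc k))))
      where
      lemma : ∀ x → - x ≡ - (+ 1) * x + + 0
      lemma = solve-∀

  -- Passing the value as `x` lets nested applications build p₁ c_k + (p₂ c_{k-1} + ...) in the
  -- bracketing that `newton-elimination` expects.
  T-suc : ∀ s k {x} → T (suc s) k ≡ x → T s (suc k) ≡ trace s * c (suc k) + x
  T-suc s k h = trans (T-rec s (suc k)) (+-congˡ (trace s * c (suc k)) h)

  newton : ∀ k {x} → T 1 k ≡ x → + suc k * c (suc k) + x ≡ + 0
  newton k {x} h = trans (cong (_+ x) (trans (euler k) (cong -_ h))) (ℤₚ.+-inverseˡ x)

-- From det(x I - L) to det(I - t L)

-- Q is P read backwards, in degree n: this relates det(x I - L) to det(I - t L) with t = 1/x.
record Reversal (n : ℕ) (P Q : Seq) : Set where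
  field
    flip   : ∀ k j → k ℕ.+ j ≡ n → P k ≡ Q j
    boundP : ∀ k → n ℕ.< k → P k ≡ + 0
    boundQ : ∀ k → n ℕ.< k → Q k ≡ + 0

-- The index is the reversal in degree 1: a + b x becomes b + a t, and a constant a becomes a t. Two
-- constructors, because `xI-L` has lists of different lengths on and off the diagonal.
data Linear : Poly → Entry → Set where
  constant : ∀ a → Linear (a ∷ []) (+ 0 , a)
  linear   : ∀ a b → Linear (a ∷ b ∷ []) (b , a)

coeff-⊕ : ∀ p q k → coeff (p ⊕ q) k ≡ coeff p k + coeff q k
coeff-⊕ []      q       k       = sym (ℤₚ.+-identityˡ (coeff q k))
coeff-⊕ (a ∷ p) []      k       = sym (ℤₚ.+-identityʳ (coeff (a ∷ p) k))
coeff-⊕ (a ∷ p) (b ∷ q) zero    = refl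
coeff-⊕ (a ∷ p) (b ∷ q) (suc k) = coeff-⊕ p q k

coeff-scale : ∀ c p k → coeff (scale c p) k ≡ c * coeff p k
coeff-scale c []      k       = sym (ℤₚ.*-zeroʳ c)
coeff-scale c (a ∷ p) zero    = refl
coeff-scale c (a ∷ p) (suc k) = coeff-scale c p k

coeff-ΣP : ∀ {n} (f : Fin n → Poly) k → coeff (ΣP f) k ≡ Σℤ λ j → coeff (f j) k
coeff-ΣP {zero}  f k = refl
coeff-ΣP {suc n} f k = trans (coeff-⊕ (f zero) (ΣP (f ∘ suc)) k) (+-congˡ (coeff (f zero) k) (coeff-ΣP (f ∘ suc) k))

coeff-[0] : ∀ k → coeff (+ 0 ∷ []) k ≡ + 0
coeff-[0] zero    = refl
coeff-[0] (suc k) = refl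

coeff-⊗ : ∀ {p b a} → Linear p (b , a) → ∀ q k → coeff (p ⊗ q) k ≡ a * coeff q k + b * shift (coeff q) k
coeff-⊗ (constant a) q k = trans (coeff-⊕ (scale a q) (+ 0 ∷ []) k) (cong₂ _+_ (coeff-scale a q k) (coeff-[0] k))
coeff-⊗ (linear a b) q zero = trans (coeff-⊕ (scale a q) (+ 0 ∷ ((b ∷ []) ⊗ q)) 0)
  (cong₂ _+_ (coeff-scale a q 0) (sym (ℤₚ.*-zeroʳ b)))
coeff-⊗ (linear a b) q (suc k) = trans (coeff-⊕ (scale a q) (+ 0 ∷ ((b ∷ []) ⊗ q)) (suc k))
  (cong₂ _+_ (coeff-scale a q (suc k)) (trans (coeff-⊗ (constant b) q k) (ℤₚ.+-identityʳ (b * coeff q k))))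

-- Reversal exchanges the roles of the two coefficients of an entry, and with them the shifted and
-- the unshifted minor. At the ends of the range the shifted side is 0 by definition and the other
-- side is coefficient n + 1 of a minor, which is why the bounds are carried through the induction.
det-reversal : ∀ {n} (M : Fin n → Fin n → Poly) (N : Mat n) → (∀ i j → Linear (M i j) (N i j)) →
  Reversal n (coeff (det M)) (detₜ N)
det-reversal {zero} M N lin = record
  { flip   = λ { zero zero refl → refl }
  ; boundP = λ { (suc k) _ → refl }
  ; boundQ = λ { (suc k) _ → refl } }
det-reversal {suc n} M N lin = record
  { flip   = λ k j k+j → trans (expand k) (Σ-cong λ l → *-congˡ (sgn l) (begin
      proj₂ (N zero l) * P l k + proj₁ (N zero l) * shift (P l) k
        ≡⟨ ℤₚ.+-comm (proj₂ (N zero l) * P l k) _ ⟩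
      proj₁ (N zero l) * shift (P l) k + proj₂ (N zero l) * P l k
        ≡⟨ cong₂ (λ x y → proj₁ (N zero l) * x + proj₂ (N zero l) * y) (shiftP l k j k+j) (shiftQ l k j k+j) ⟩
      (N zero l • Q l) j ∎))
  ; boundP = λ { (suc k) (s≤s n<k) → trans (expand (suc k)) (Σ-zero λ l → trans (*-congˡ (sgn l)
      (cong₂ (λ x y → proj₂ (N zero l) * x + proj₁ (N zero l) * y)
        (boundP (rev l) (suc k) (ℕₚ.m<n⇒m<1+n n<k)) (boundP (rev l) k n<k)))
      (vanish (sgn l) (proj₂ (N zero l)) (proj₁ (N zero l)))) }
  ; boundQ = λ { (suc k) (s≤s n<k) → Σ-zero λ l → trans (*-congˡ (sgn l)
      (cong₂ (λ x y → proj₁ (N zero l) * x + proj₂ (N zero l) * y)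
        (boundQ (rev l) (suc k) (ℕₚ.m<n⇒m<1+n n<k)) (boundQ (rev l) k n<k)))
      (vanish (sgn l) (proj₁ (N zero l)) (proj₂ (N zero l))) } }
  where
  open Reversal

  P Q : Fin (suc n) → Seq
  P l = coeff (det λ r c → M (suc r) (punchIn l c))
  Q l = detₜ (minor l N)

  rev : ∀ l → Reversal n (P l) (Q l)
  rev l = det-reversal (λ r c → M (suc r) (punchIn l c)) (minor l N) (λ r c → lin (suc r) (punchIn l c))

  expand : ∀ k → coeff (det M) k ≡ Σℤ λ l → sgn l * (proj₂ (N zero l) * P l k + proj₁ (N zero l) * shift (P l) k)
  expand k = trans (coeff-ΣP (λ l → scale (sgn l) (M zero l ⊗ det (λ r c → M (suc r) (punchIn l c)))) k)
    (Σ-cong λ l → trans (coeff-scale (sgn l) (M zero l ⊗ det (λ r c → M (suc r) (punchIn l c))) k)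
      (*-congˡ (sgn l) (coeff-⊗ (lin zero l) (det (λ r c → M (suc r) (punchIn l c))) k)))

  vanish : ∀ s x y → s * (x * + 0 + y * + 0) ≡ + 0
  vanish = solve-∀

  shiftP : ∀ l k j → k ℕ.+ j ≡ suc n → shift (P l) k ≡ Q l j
  shiftP l zero    j refl = sym (boundQ (rev l) j (ℕₚ.n<1+n n))
  shiftP l (suc k) j k+j  = flip (rev l) k j (ℕₚ.suc-injective k+j)

  shiftQ : ∀ l k j → k ℕ.+ j ≡ suc n → P l k ≡ shift (Q l) j
  shiftQ l k zero    k+0 = boundP (rev l) k (subst (n ℕ.<_) (trans (sym k+0) (ℕₚ.+-identityʳ k)) (ℕₚ.n<1+n n))
  shiftQ l k (suc j) k+j = flip (rev l) k j (ℕₚ.suc-injective (trans (sym (ℕₚ.+-suc k j)) k+j))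

-- The test i ≟ j occurs twice: in xI-L, and in the laplacian entry which then appears.
laplacian-linear : ∀ {n} (G : SimpleGraph n) i j → Linear (xI-L G i j) (δ i j , - laplacian G i j)
laplacian-linear G i j with i ≟ j
... | yes p with i ≟ j
...   | yes _ = linear (- deg G i) (+ 1)
...   | no ¬p = contradiction p ¬p
laplacian-linear G i j | no ¬p with i ≟ j
...   | yes p = contradiction p ¬p
...   | no _  = constant (- - b2z (adj G i j))

lapCoeff-reversal : ∀ {n} (G : SimpleGraph n) k → k ≤ n → lapCoeff G (n ∸ k) ≡ sign k * CharPoly.c (laplacian G) k
lapCoeff-reversal {n} G k k≤n = cong₂ (λ j x → sign j * x) (ℕₚ.m∸[m∸n]≡n k≤n)
  (Reversal.flip (det-reversal (xI-L G) _ (laplacian-linear G)) (n ∸ k) k (ℕₚ.m∸n+n≡m k≤n))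

-- Elimination of the lower coefficients

-- The coefficient of each product of the p's is the number of permutations of six letters with that
-- cycle type, times their sign: 1, 15, 40, 45, 90, 120, 144, 15, 90, 40, 120 add up to 720.
newton-elimination : ∀ p₁ p₂ p₃ p₄ p₅ p₆ c₁ c₂ c₃ c₄ c₅ c₆ →
  + 1 * c₁ + p₁ ≡ + 0 →
  + 2 * c₂ + (p₁ * c₁ + p₂) ≡ + 0 →
  + 3 * c₃ + (p₁ * c₂ + (p₂ * c₁ + p₃)) ≡ + 0 →
  + 4 * c₄ + (p₁ * c₃ + (p₂ * c₂ + (p₃ * c₁ + p₄))) ≡ + 0 →
  + 5 * c₅ + (p₁ * c₄ + (p₂ * c₃ + (p₃ * c₂ + (p₄ * c₁ + p₅)))) ≡ + 0 →
  + 6 * c₆ + (p₁ * c₅ + (p₂ * c₄ + (p₃ * c₃ + (p₄ * c₂ + (p₅ * c₁ + p₆))))) ≡ + 0 →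
  + 720 * c₆ ≡ p₁ * p₁ * p₁ * p₁ * p₁ * p₁ - + 15 * (p₁ * p₁ * p₁ * p₁ * p₂) + + 40 * (p₁ * p₁ * p₁ * p₃)
    + + 45 * (p₁ * p₁ * p₂ * p₂) - + 90 * (p₁ * p₁ * p₄) - + 120 * (p₁ * p₂ * p₃) + + 144 * (p₁ * p₅)
    - + 15 * (p₂ * p₂ * p₂) + + 90 * (p₂ * p₄) + + 40 * (p₃ * p₃) - + 120 * p₆
newton-elimination p₁ p₂ p₃ p₄ p₅ p₆ c₁ c₂ c₃ c₄ c₅ c₆ h₁ h₂ h₃ h₄ h₅ h₆ =
  trans (combination p₁ p₂ p₃ p₄ p₅ p₆ c₁ c₂ c₃ c₄ c₅ c₆) (trans (F-cong h₁ h₂ h₃ h₄ h₅ h₆) (F-zero p₁ p₂ p₃ p₄ p₅ p₆))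
  where
  -- The multipliers arise by successively eliminating c₅, c₄, … from 720 c₆.
  F : (r₁ r₂ r₃ r₄ r₅ r₆ : ℤ) → ℤ
  F r₁ r₂ r₃ r₄ r₅ r₆ = p₁ * p₁ * p₁ * p₁ * p₁ * p₁ - + 15 * (p₁ * p₁ * p₁ * p₁ * p₂) + + 40 * (p₁ * p₁ * p₁ * p₃)
    + + 45 * (p₁ * p₁ * p₂ * p₂) - + 90 * (p₁ * p₁ * p₄) - + 120 * (p₁ * p₂ * p₃) + + 144 * (p₁ * p₅)
    - + 15 * (p₂ * p₂ * p₂) + + 90 * (p₂ * p₄) + + 40 * (p₃ * p₃) - + 120 * p₆
    + (+ 120 * r₆ - + 24 * p₁ * r₅ + (+ 6 * (p₁ * p₁) - + 30 * p₂) * r₄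
      + (+ 18 * (p₁ * p₂) - + 2 * (p₁ * p₁ * p₁) - + 40 * p₃) * r₃
      + (p₁ * p₁ * p₁ * p₁ - + 12 * (p₁ * p₁ * p₂) + + 15 * (p₂ * p₂) + + 32 * (p₁ * p₃) - + 60 * p₄) * r₂
      + (+ 14 * (p₁ * p₁ * p₁ * p₂) - p₁ * p₁ * p₁ * p₁ * p₁ - + 33 * (p₁ * p₂ * p₂) - + 38 * (p₁ * p₁ * p₃)
          + + 70 * (p₂ * p₃) + + 84 * (p₁ * p₄) - + 120 * p₅) * r₁)

  -- The left sides of the hypotheses are compound terms that cannot be matched with `refl`; here
  -- they are abstracted to variables.
  F-cong : ∀ {r₁ r₂ r₃ r₄ r₅ r₆} →
    r₁ ≡ + 0 → r₂ ≡ + 0 → r₃ ≡ + 0 → r₄ ≡ + 0 → r₅ ≡ + 0 → r₆ ≡ + 0 →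
    F r₁ r₂ r₃ r₄ r₅ r₆ ≡ F (+ 0) (+ 0) (+ 0) (+ 0) (+ 0) (+ 0)
  F-cong refl refl refl refl refl refl = refl

  combination : ∀ p₁ p₂ p₃ p₄ p₅ p₆ c₁ c₂ c₃ c₄ c₅ c₆ →
    let r₁ = + 1 * c₁ + p₁
        r₂ = + 2 * c₂ + (p₁ * c₁ + p₂)
        r₃ = + 3 * c₃ + (p₁ * c₂ + (p₂ * c₁ + p₃))
        r₄ = + 4 * c₄ + (p₁ * c₃ + (p₂ * c₂ + (p₃ * c₁ + p₄)))
        r₅ = + 5 * c₅ + (p₁ * c₄ + (p₂ * c₃ + (p₃ * c₂ + (p₄ * c₁ + p₅))))
        r₆ = + 6 * c₆ + (p₁ * c₅ + (p₂ * c₄ + (p₃ * c₃ + (p₄ * c₂ + (p₅ * c₁ + p₆)))))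
    in + 720 * c₆ ≡ p₁ * p₁ * p₁ * p₁ * p₁ * p₁ - + 15 * (p₁ * p₁ * p₁ * p₁ * p₂) + + 40 * (p₁ * p₁ * p₁ * p₃)
      + + 45 * (p₁ * p₁ * p₂ * p₂) - + 90 * (p₁ * p₁ * p₄) - + 120 * (p₁ * p₂ * p₃) + + 144 * (p₁ * p₅)
      - + 15 * (p₂ * p₂ * p₂) + + 90 * (p₂ * p₄) + + 40 * (p₃ * p₃) - + 120 * p₆
      + (+ 120 * r₆ - + 24 * p₁ * r₅ + (+ 6 * (p₁ * p₁) - + 30 * p₂) * r₄
        + (+ 18 * (p₁ * p₂) - + 2 * (p₁ * p₁ * p₁) - + 40 * p₃) * r₃
        + (p₁ * p₁ * p₁ * p₁ - + 12 * (p₁ * p₁ * p₂) + + 15 * (p₂ * p₂) + + 32 * (p₁ * p₃) - + 60 * p₄) * r₂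
        + (+ 14 * (p₁ * p₁ * p₁ * p₂) - p₁ * p₁ * p₁ * p₁ * p₁ - + 33 * (p₁ * p₂ * p₂) - + 38 * (p₁ * p₁ * p₃)
          + + 70 * (p₂ * p₃) + + 84 * (p₁ * p₄) - + 120 * p₅) * r₁)
  combination = solve-∀

  F-zero : ∀ p₁ p₂ p₃ p₄ p₅ p₆ →
    p₁ * p₁ * p₁ * p₁ * p₁ * p₁ - + 15 * (p₁ * p₁ * p₁ * p₁ * p₂) + + 40 * (p₁ * p₁ * p₁ * p₃)
      + + 45 * (p₁ * p₁ * p₂ * p₂) - + 90 * (p₁ * p₁ * p₄) - + 120 * (p₁ * p₂ * p₃) + + 144 * (p₁ * p₅)
      - + 15 * (p₂ * p₂ * p₂) + + 90 * (p₂ * p₄) + + 40 * (p₃ * p₃) - + 120 * p₆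
      + (+ 120 * + 0 - + 24 * p₁ * + 0 + (+ 6 * (p₁ * p₁) - + 30 * p₂) * + 0
        + (+ 18 * (p₁ * p₂) - + 2 * (p₁ * p₁ * p₁) - + 40 * p₃) * + 0
        + (p₁ * p₁ * p₁ * p₁ - + 12 * (p₁ * p₁ * p₂) + + 15 * (p₂ * p₂) + + 32 * (p₁ * p₃) - + 60 * p₄) * + 0
        + (+ 14 * (p₁ * p₁ * p₁ * p₂) - p₁ * p₁ * p₁ * p₁ * p₁ - + 33 * (p₁ * p₂ * p₂) - + 38 * (p₁ * p₁ * p₃)
          + + 70 * (p₂ * p₃) + + 84 * (p₁ * p₄) - + 120 * p₅) * + 0)
    ≡ p₁ * p₁ * p₁ * p₁ * p₁ * p₁ - + 15 * (p₁ * p₁ * p₁ * p₁ * p₂) + + 40 * (p₁ * p₁ * p₁ * p₃)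
      + + 45 * (p₁ * p₁ * p₂ * p₂) - + 90 * (p₁ * p₁ * p₄) - + 120 * (p₁ * p₂ * p₃) + + 144 * (p₁ * p₅)
      - + 15 * (p₂ * p₂ * p₂) + + 90 * (p₂ * p₄) + + 40 * (p₃ * p₃) - + 120 * p₆
  F-zero = solve-∀

-- Short walks in a forest

-- Profile of a pair of vertices at distance 0, 1, 2, 3 or more: the values there of the identity matrix,
-- of A, of A², A D A, A D² A and of A³, where s and s₂ stand for the sums of deg and deg² over the
-- neighbours of the first vertex.
data Profile (di dj s s₂ : ℤ) : (e a x w w₂ y : ℤ) → Set where
  same  : dj ≡ di → Profile di dj s s₂ (+ 1) (+ 0) di s s₂ (+ 0)
  edge  : Profile di dj s s₂ (+ 0) (+ 1) (+ 0) (+ 0) (+ 0) (di + dj - + 1)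
  two   : ∀ v → Profile di dj s s₂ (+ 0) (+ 0) (+ 1) v (v * v) (+ 0)
  three : Profile di dj s s₂ (+ 0) (+ 0) (+ 0) (+ 0) (+ 0) (+ 1)
  far   : Profile di dj s s₂ (+ 0) (+ 0) (+ 0) (+ 0) (+ 0) (+ 0)

Profile-resp : ∀ {di dj s s₂ e a x w w₂ y e′ a′ x′ w′ w₂′ y′} →
  e ≡ e′ → a ≡ a′ → x ≡ x′ → w ≡ w′ → w₂ ≡ w₂′ → y ≡ y′ →
  Profile di dj s s₂ e′ a′ x′ w′ w₂′ y′ → Profile di dj s s₂ e a x w w₂ y
Profile-resp refl refl refl refl refl refl p = p

b2z-* : ∀ b {y} → (b ≡ true → y ≡ + 0) → b2z b * y ≡ + 0
b2z-* true  h = cong (λ z → + 1 * z) (h refl)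
b2z-* false h = refl

module Walk {n} (G : SimpleGraph n) where

  A : Fin n → Fin n → ℤ
  A i j = b2z (adj G i j)

  d : Fin n → ℤ
  d = deg G

  S : (Fin n → ℤ) → Fin n → ℤ
  S w i = Σℤ λ k → A i k * w k

  -- The matrix A diag(w) A. With the weight as a parameter, one argument serves A², A D A and A D²
  -- A.
  W : (Fin n → ℤ) → Fin n → Fin n → ℤ
  W w i j = Σℤ λ k → A i k * (w k * A k j)

  𝟙 d² : Fin n → ℤ
  𝟙 _  = + 1
  d² k = d k * d k

  A² A³ : Fin n → Fin n → ℤ
  A² = W 𝟙
  A³ i j = Σℤ λ k → A i k * A² k j

  A-sym : ∀ i j → A i j ≡ A j i
  A-sym i j = cong b2z (symm G i j)

  A-adj : ∀ {i j} → Adj G i j → A i j ≡ + 1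
  A-adj = cong b2z

  A-nonadj : ∀ {i j} → ¬ Adj G i j → A i j ≡ + 0
  A-nonadj {i} {j} ¬p with adj G i j
  ... | true  = contradiction refl ¬p
  ... | false = refl

  A-diag : ∀ i → A i i ≡ + 0
  A-diag i = cong b2z (irrefl G i)

  Adj-sym : ∀ {i j} → Adj G i j → Adj G j i
  Adj-sym {i} {j} p = trans (symm G j i) p

  Adj-≢ : ∀ {i j} → Adj G i j → i ≢ j
  Adj-≢ {i} p refl with trans (sym p) (irrefl G i)
  ... | ()

  laplacian-δA : ∀ i j → laplacian G i j ≡ δ i j * d i - A i j
  laplacian-δA i j with i ≟ j
  ... | yes refl = trans (lemma (d i)) (cong (λ z → + 1 * d i - z) (sym (A-diag i)))
    where
    lemma : ∀ x → x ≡ + 1 * x - + 0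
    lemma = solve-∀
  ... | no _ = lemma (d i) (A i j)
    where
    lemma : ∀ x y → - y ≡ + 0 * x - y
    lemma = solve-∀

  S-1 : ∀ i → S 𝟙 i ≡ d i
  S-1 i = Σ-cong λ k → ℤₚ.*-identityʳ (A i k)

  W-diag : ∀ w i → W w i i ≡ S w i
  W-diag w i = Σ-cong λ k → trans (cong (λ z → A i k * (w k * z)) (A-sym k i)) (idem (adj G i k) (w k))
    where
    idem : ∀ b w → b2z b * (w * b2z b) ≡ b2z b * w
    idem true  w = cong (λ z → + 1 * z) (ℤₚ.*-identityʳ w)
    idem false w = refl

  W-none : ∀ w i j → (∀ k → Adj G i k → Adj G k j → ⊥) → W w i j ≡ + 0
  W-none w i j h = Σ-zero λ k → b2z-* (adj G i k) λ ik →
    trans (*-congˡ (w k) (A-nonadj (h k ik))) (ℤₚ.*-zeroʳ (w k))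

  W-unique : ∀ w i j k → Adj G i k → Adj G k j → (∀ l → Adj G i l → Adj G l j → l ≡ k) → W w i j ≡ w k
  W-unique w i j k ik kj h = trans
    (Σ-at k _ λ l l≢k → b2z-* (adj G i l) λ il →
      trans (*-congˡ (w l) (A-nonadj λ lj → l≢k (h l il lj))) (ℤₚ.*-zeroʳ (w l)))
    (trans (cong₂ (λ x y → x * (w k * y)) (A-adj ik) (A-adj kj)) (lemma (w k)))
    where
    lemma : ∀ x → + 1 * (x * + 1) ≡ x
    lemma = solve-∀

  A³-none : ∀ i j → (∀ k → Adj G i k → A² k j ≡ + 0) → A³ i j ≡ + 0
  A³-none i j h = Σ-zero λ k → b2z-* (adj G i k) (h k)

  module Forest (forest : IsForest G) where

    no3 : ∀ {a b c} → Adj G a b → Adj G b c → Adj G c a → ⊥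
    no3 {a} {b} {c} ab bc ca = forest (a ∷ b ∷ c ∷ [])
      ( a , c , step ab (step bc (single c)) , ca
      , (Adj-≢ ab ∷ₐ Adj-≢ ca ∘ sym ∷ₐ []ₐ) ∷ₚ (Adj-≢ bc ∷ₐ []ₐ) ∷ₚ []ₐ ∷ₚ []ₚ
      , s≤s (s≤s (s≤s z≤n)))

    -- Neighbours on the walk differ already, so only the two pairs of opposite vertices need
    -- hypotheses.
    no4 : ∀ {a b c e} → Adj G a b → Adj G b c → Adj G c e → Adj G e a → a ≢ c → b ≢ e → ⊥
    no4 {a} {b} {c} {e} ab bc ce ea a≢c b≢e = forest (a ∷ b ∷ c ∷ e ∷ [])
      ( a , e , step ab (step bc (step ce (single e))) , ea
      , (Adj-≢ ab ∷ₐ a≢c ∷ₐ Adj-≢ ea ∘ sym ∷ₐ []ₐ) ∷ₚ (Adj-≢ bc ∷ₐ b≢e ∷ₐ []ₐ) ∷ₚ (Adj-≢ ce ∷ₐ []ₐ) ∷ₚ []ₐ ∷ₚ []ₚ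
      , s≤s (s≤s (s≤s z≤n)))

    -- If two vertices two steps apart on a closed walk of length 5 coincided, a triangle would be left.
    no5 : ∀ {a b c e f} → Adj G a b → Adj G b c → Adj G c e → Adj G e f → Adj G f a → ⊥
    no5 {a} {b} {c} {e} {f} ab bc ce ef fa = forest (a ∷ b ∷ c ∷ e ∷ f ∷ [])
      ( a , f , step ab (step bc (step ce (step ef (single f)))) , fa
      , (Adj-≢ ab ∷ₐ (λ { refl → no3 ce ef fa }) ∷ₐ (λ { refl → no3 ab bc ce }) ∷ₐ Adj-≢ fa ∘ sym ∷ₐ []ₐ)
        ∷ₚ (Adj-≢ bc ∷ₐ (λ { refl → no3 ab ef fa }) ∷ₐ (λ { refl → no3 bc ce ef }) ∷ₐ []ₐ)
        ∷ₚ (Adj-≢ ce ∷ₐ (λ { refl → no3 ab bc fa }) ∷ₐ []ₐ)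
        ∷ₚ (Adj-≢ ef ∷ₐ []ₐ) ∷ₚ []ₐ ∷ₚ []ₚ
      , s≤s (s≤s (s≤s z≤n)))

    -- Vertices two steps apart may coincide by backtracking, hence the six hypotheses. A
    -- coincidence three steps apart would leave a triangle.
    no6 : ∀ {a b c e f g} → Adj G a b → Adj G b c → Adj G c e → Adj G e f → Adj G f g → Adj G g a →
      a ≢ c → b ≢ e → c ≢ f → e ≢ g → f ≢ a → g ≢ b → ⊥
    no6 {a} {b} {c} {e} {f} {g} ab bc ce ef fg ga a≢c b≢e c≢f e≢g f≢a g≢b = forest (a ∷ b ∷ c ∷ e ∷ f ∷ g ∷ [])
      ( a , g , step ab (step bc (step ce (step ef (step fg (single g))))) , ga
      , (Adj-≢ ab ∷ₐ a≢c ∷ₐ (λ { refl → no3 ab bc ce }) ∷ₐ f≢a ∘ sym ∷ₐ Adj-≢ ga ∘ sym ∷ₐ []ₐ)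
        ∷ₚ (Adj-≢ bc ∷ₐ b≢e ∷ₐ (λ { refl → no3 bc ce ef }) ∷ₐ g≢b ∘ sym ∷ₐ []ₐ)
        ∷ₚ (Adj-≢ ce ∷ₐ c≢f ∷ₐ (λ { refl → no3 ce ef fg }) ∷ₐ []ₐ)
        ∷ₚ (Adj-≢ ef ∷ₐ e≢g ∷ₐ []ₐ) ∷ₚ (Adj-≢ fg ∷ₐ []ₐ) ∷ₚ []ₐ ∷ₚ []ₚ
      , s≤s (s≤s (s≤s z≤n)))

    W-edge : ∀ w {i j} → Adj G i j → W w i j ≡ + 0
    W-edge w {i} {j} ij = W-none w i j λ k ik kj → no3 ik kj (Adj-sym ij)

    -- A second common neighbour of i and j would complete a 4-cycle.
    W-two : ∀ w {i j k} → i ≢ j → Adj G i k → Adj G k j → W w i j ≡ w k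
    W-two w {i} {j} {k} i≢j ik kj = W-unique w i j k ik kj only
      where
      only : ∀ l → Adj G i l → Adj G l j → l ≡ k
      only l il lj with l ≟ k
      ... | yes p = p
      ... | no l≢k = ⊥-elim (no4 il lj (Adj-sym kj) (Adj-sym ik) i≢j l≢k)

    -- Walks of length 3 from i to j, by their second vertex k: for k = j there are d j of them, and
    -- any other neighbour k of i admits only the return through i, which gives d i - 1 more.
    A³-edge : ∀ {i j} → Adj G i j → A³ i j ≡ d i + d j - + 1
    A³-edge {i} {j} ij = begin
      Σℤ (λ k → A i k * A² k j)
        ≡⟨ Σ-cong term ⟩
      Σℤ (λ k → A i k + (d k - + 1) * δ k j)
        ≡⟨ Σ-+ (A i) (λ k → (d k - + 1) * δ k j) ⟩
      d i + Σℤ (λ k → (d k - + 1) * δ k j)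
        ≡⟨ +-congˡ (d i) (Σ-δʳ j (λ k → d k - + 1)) ⟩
      d i + (d j - + 1)
        ≡⟨ ℤₚ.+-assoc (d i) (d j) (- (+ 1)) ⟨
      d i + d j - + 1 ∎
      where
      term : ∀ k → A i k * A² k j ≡ A i k + (d k - + 1) * δ k j
      term k with k ≟ j
      ... | yes refl = trans (cong₂ _*_ (A-adj ij) (trans (W-diag 𝟙 j) (S-1 j)))
                         (trans (lemma (d j)) (cong (λ z → z + (d j - + 1) * + 1) (sym (A-adj ij))))
        where
        lemma : ∀ x → + 1 * x ≡ + 1 + (x - + 1) * + 1
        lemma = solve-∀
      ... | no k≢j = go (adj G i k) refl
        where
        lemma : ∀ x y → x ≡ x + y * + 0
        lemma = solve-∀
        go : ∀ b → adj G i k ≡ b → b2z b * A² k j ≡ b2z b + (d k - + 1) * + 0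
        go true  ik = trans (cong (λ z → + 1 * z) (W-two 𝟙 k≢j (Adj-sym ik) ij)) (lemma (+ 1) (d k - + 1))
        go false _  = lemma (+ 0) (d k - + 1)

    A³-three : ∀ {i j a b} → Adj G i a → Adj G a b → Adj G b j → i ≢ b → a ≢ j → A³ i j ≡ + 1
    A³-three {i} {j} {a} {b} ia ab bj i≢b a≢j = trans
      (Σ-at a _ λ l l≢a → b2z-* (adj G i l) λ il → W-none 𝟙 l j λ x lx xj →
        -- Another walk i, l, x, j with l different from a would close up with j, b, a to a 6-cycle.
        -- If x = b, a 4-cycle through i, a, b, l is left; if l = j or x = i, then i and j are
        -- adjacent.
        no6 ia ab bj (Adj-sym xj) (Adj-sym lx) (Adj-sym il)
          i≢b a≢j (λ { refl → no4 ia ab (Adj-sym lx) (Adj-sym il) i≢b (l≢a ∘ sym) })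
          (λ { refl → ¬ij il }) (λ { refl → ¬ij xj }) l≢a)
      (cong₂ _*_ (A-adj ia) (W-two 𝟙 a≢j ab bj))
      where
      ¬ij : ¬ Adj G i j
      ¬ij ij = no4 ia ab bj (Adj-sym ij) i≢b a≢j

    Adj? : ∀ i j → Dec (Adj G i j)
    Adj? i j = adj G i j Bool.≟ true

    -- The tests run through increasing distance, and each failed test excludes degenerate walks in
    -- the later cases.
    profile : ∀ i j → Profile (d i) (d j) (S d i) (S d² i)
      (δ i j) (A i j) (A² i j) (W d i j) (W d² i j) (A³ i j)
    profile i j with i ≟ j
    ... | yes refl = Profile-resp refl (A-diag i) (trans (W-diag 𝟙 i) (S-1 i)) (W-diag d i) (W-diag d² i)
            (A³-none i i λ k ik → W-edge 𝟙 (Adj-sym ik)) (same refl)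
    ... | no i≢j with Adj? i j
    ... | yes ij = Profile-resp refl (A-adj ij) (W-edge 𝟙 ij) (W-edge d ij) (W-edge d² ij) (A³-edge ij) edge
    ... | no ¬ij with any? (λ k → Adj? i k ×-dec Adj? k j)
    ... | yes (k , ik , kj) = Profile-resp refl (A-nonadj ¬ij) (W-two 𝟙 i≢j ik kj) (W-two d i≢j ik kj) (W-two d² i≢j ik kj)
            -- A walk of length 3 from i to j would close up with j, k, i to a walk of length 5.
            (A³-none i j λ l il → W-none 𝟙 l j λ x lx xj → no5 il lx xj (Adj-sym kj) (Adj-sym ik))
            (two (d k))
    ... | no ¬2 with any? (λ a → any? (λ b → Adj? i a ×-dec Adj? a b ×-dec Adj? b j ×-dec ¬? (i ≟ b) ×-dec ¬? (a ≟ j)))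
    ... | yes (a , b , ia , ab , bj , i≢b , a≢j) = Profile-resp refl (A-nonadj ¬ij) (none 𝟙) (none d) (none d²)
            (A³-three ia ab bj i≢b a≢j) three
      where
      none : ∀ w → W w i j ≡ + 0
      none w = W-none w i j λ k ik kj → ¬2 (k , ik , kj)
    ... | no ¬3 = Profile-resp refl (A-nonadj ¬ij) (none 𝟙) (none d) (none d²)
            (A³-none i j λ l il → W-none 𝟙 l j λ x lx xj →
              -- If the walk i, l, x, j revisited one of its ends, it would contain an edge between
              -- i and j.
              ¬3 (l , x , il , lx , xj , (λ { refl → ¬ij xj }) , (λ { refl → ¬ij il }))) far
      where
      none : ∀ w → W w i j ≡ + 0
      none w = W-none w i j λ k ik kj → ¬2 (k , ik , kj)

-- Products of entries of L, L² and L³ at a given distance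

profile-L¹L¹ : ∀ {di dj s s₂ e a x w w₂ y} → Profile di dj s s₂ e a x w w₂ y →
  (e * di - a) * (e * di - a) ≡ e * (di * di) + a
profile-L¹L¹ {di} (same _) = solve (di ∷ [])
profile-L¹L¹ {di} edge = solve (di ∷ [])
profile-L¹L¹ {di} (two _) = solve (di ∷ [])
profile-L¹L¹ {di} three = solve (di ∷ [])
profile-L¹L¹ {di} far = solve (di ∷ [])

profile-L¹L² : ∀ {di dj s s₂ e a x w w₂ y} → Profile di dj s s₂ e a x w w₂ y →
  (e * di - a) * (e * (di * di) - a * (di + dj) + x)
    ≡ e * (di * di * di) + (e * (di * di) + (a * di + a * dj))
profile-L¹L² {di} (same refl) = solve (di ∷ [])
profile-L¹L² {di} {dj} edge = solve (di ∷ dj ∷ [])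
profile-L¹L² {di} {dj} (two _) = solve (di ∷ dj ∷ [])
profile-L¹L² {di} {dj} three = solve (di ∷ dj ∷ [])
profile-L¹L² {di} {dj} far = solve (di ∷ dj ∷ [])

-- Each term keeps a single matrix letter, so that it can be summed separately. The letter x also
-- takes the value di on the diagonal; the term in `- (+ 1)` removes that surplus.
profile-L²L² : ∀ {di dj s s₂ e a x w w₂ y} → Profile di dj s s₂ e a x w w₂ y →
  (e * (di * di) - a * (di + dj) + x) * (e * (di * di) - a * (di + dj) + x)
    ≡ e * (di * di * di * di) + (+ 2 * (e * (di * di * di)) + (e * (di * di) + (- (+ 1) * (e * di)
      + (a * (di * di) + (a * (dj * dj) + (+ 2 * (a * (di * dj)) + x))))))
profile-L²L² {di} (same refl) = solve (di ∷ [])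
profile-L²L² {di} {dj} edge = solve (di ∷ dj ∷ [])
profile-L²L² {di} {dj} (two _) = solve (di ∷ dj ∷ [])
profile-L²L² {di} {dj} three = solve (di ∷ dj ∷ [])
profile-L²L² {di} {dj} far = solve (di ∷ dj ∷ [])

profile-L²L³ : ∀ {di dj s s₂ e a x w w₂ y} → Profile di dj s s₂ e a x w w₂ y →
  (e * (di * di) - a * (di + dj) + x)
    * (e * (di * di * di) - a * (di * di + di * dj + dj * dj) + x * (di + dj) + w - y)
    ≡ e * (di * di * di * di * di) + (+ 3 * (e * (di * di * di * di)) + (+ 2 * (e * (di * di * di))
      + (- (+ 2) * (e * (di * di)) + (e * (di * di * s) + (e * (di * s) + (- (+ 1) * (e * s)
      + (a * (di * di * di) + (a * (dj * dj * dj) + (+ 2 * (a * (di * di * dj)) + (+ 2 * (a * (di * (dj * dj)))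
      + (a * (di * di) + (a * (dj * dj) + (+ 2 * (a * (di * dj)) + (- (+ 1) * (a * di) + (- (+ 1) * (a * dj)
      + (x * di + (x * dj + w)))))))))))))))))
profile-L²L³ {di} {s = s} (same refl) = solve (di ∷ s ∷ [])
profile-L²L³ {di} {dj} {s} edge = solve (di ∷ dj ∷ s ∷ [])
profile-L²L³ {di} {dj} {s} (two v) = solve (di ∷ dj ∷ s ∷ v ∷ [])
profile-L²L³ {di} {dj} {s} three = solve (di ∷ dj ∷ s ∷ [])
profile-L²L³ {di} {dj} {s} far = solve (di ∷ dj ∷ s ∷ [])

-- At distance two the square of w is v * v, which is why A D² A appears in `Profile`. With u = di +
-- dj, an edge contributes (u - 1)² from the square of y, while the linear y already supplies u - 1;
-- the difference u² - 3 u + 2 explains the coefficients - 3 and + 2. The negative `e` terms again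
-- cancel diagonal values, here of x, w and w₂.
profile-L³L³ : ∀ {di dj s s₂ e a x w w₂ y} → Profile di dj s s₂ e a x w w₂ y →
  (e * (di * di * di) - a * (di * di + di * dj + dj * dj) + x * (di + dj) + w - y)
    * (e * (di * di * di) - a * (di * di + di * dj + dj * dj) + x * (di + dj) + w - y)
    ≡ e * (di * di * di * di * di * di) + (+ 4 * (e * (di * di * di * di * di)) + (+ 4 * (e * (di * di * di * di))
      + (- (+ 4) * (e * (di * di * di)) + (+ 2 * (e * (di * di * di * s)) + (+ 4 * (e * (di * di * s))
      + (- (+ 4) * (e * (di * s)) + (e * (s * s) + (- (+ 1) * (e * s₂)
      + (a * (di * di * di * di) + (a * (dj * dj * dj * dj) + (+ 2 * (a * (di * di * di * dj))
      + (+ 2 * (a * (di * (dj * dj * dj))) + (+ 3 * (a * (di * di * (dj * dj)))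
      + (+ 2 * (a * (di * di * di)) + (+ 2 * (a * (dj * dj * dj)) + (+ 4 * (a * (di * di * dj)) + (+ 4 * (a * (di * (dj * dj)))
      + (- (+ 1) * (a * (di * di)) + (- (+ 1) * (a * (dj * dj)) + (- (+ 3) * (a * di) + (- (+ 3) * (a * dj) + (+ 2 * a
      + (x * (di * di) + (x * (dj * dj) + (+ 2 * (x * (di * dj)) + (+ 2 * (w * di) + (+ 2 * (w * dj) + (w₂ + y))))))))))))))))))))))))))))
profile-L³L³ {di} {s = s} {s₂} (same refl) = solve (di ∷ s ∷ s₂ ∷ [])
profile-L³L³ {di} {dj} {s} {s₂} edge = solve (di ∷ dj ∷ s ∷ s₂ ∷ [])
profile-L³L³ {di} {dj} {s} {s₂} (two v) = solve (di ∷ dj ∷ s ∷ s₂ ∷ v ∷ [])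
profile-L³L³ {di} {dj} {s} {s₂} three = solve (di ∷ dj ∷ s ∷ s₂ ∷ [])
profile-L³L³ {di} {dj} {s} {s₂} far = solve (di ∷ dj ∷ s ∷ s₂ ∷ [])

-- Degree sums

-- With summand and value as parameters, sums combine without being restated; `_⊞_` associates to
-- the right like the right-hand sides of the profile identities.
record HasSum {n} (f : Fin n → Fin n → ℤ) (v : ℤ) : Set where
  constructor hasSum
  field total : Σℤ (λ i → Σℤ λ j → f i j) ≡ v
open HasSum

infixr 4 _⊞_
_⊞_ : ∀ {n u v} {f g : Fin n → Fin n → ℤ} → HasSum f u → HasSum g v → HasSum (λ i j → f i j + g i j) (u + v)
_⊞_ {f = f} {g} (hasSum refl) (hasSum refl) = hasSum (trans (Σ-cong λ i → Σ-+ (f i) (g i))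
  (Σ-+ (λ i → Σℤ (f i)) (λ i → Σℤ (g i))))

infixr 5 _⊡_
_⊡_ : ∀ {n v} c {f : Fin n → Fin n → ℤ} → HasSum f v → HasSum (λ i j → c * f i j) (c * v)
_⊡_ c {f} (hasSum refl) = hasSum (trans (Σ-cong λ i → Σ-*ˡ c (f i)) (Σ-*ˡ c (λ i → Σℤ (f i))))

reshape : ∀ {n v} {f g : Fin n → Fin n → ℤ} → (∀ i j → f i j ≡ g i j) → HasSum g v → HasSum f v
reshape h (hasSum p) = hasSum (trans (Σ-cong₂ h) p)

revalue : ∀ {n u v} {f : Fin n → Fin n → ℤ} → u ≡ v → HasSum f u → HasSum f v
revalue h (hasSum p) = hasSum (trans p h)

transpose : ∀ {n v} {f : Fin n → Fin n → ℤ} → HasSum f v → HasSum (λ i j → f j i) v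
transpose {f = f} (hasSum p) = hasSum (trans (Σ-swap (λ i j → f j i)) p)

Σpairs-cong : ∀ {n} {f g : Fin n → Fin n → ℤ} → (∀ i j → f i j ≡ g i j) → Σpairs f ≡ Σpairs g
Σpairs-cong h = Σ-cong₂ λ i j → *-congˡ (ascending i j) (h i j)

Σpairs-+ : ∀ {n} (f g : Fin n → Fin n → ℤ) → Σpairs (λ i j → f i j + g i j) ≡ Σpairs f + Σpairs g
Σpairs-+ f g = total (reshape (λ i j → ℤₚ.*-distribˡ-+ (ascending i j) (f i j) (g i j)) (hasSum refl ⊞ hasSum refl))

sum-unordered : ∀ {n} (f : Fin n → Fin n → ℤ) →
  HasSum f (Σpairs (λ i j → f i j + f j i) + Σℤ (λ i → f i i))
sum-unordered f = revalue (cong (_+ Σℤ (λ i → f i i)) (sym (Σpairs-+ f (λ i j → f j i))))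
  (reshape split ((hasSum refl ⊞ transpose (hasSum refl)) ⊞ hasSum (Σ-cong λ i → Σ-δˡ i (f i))))
  where
  distrib : ∀ a b c x → (a + b + c) * x ≡ (a * x + b * x) + c * x
  distrib = solve-∀

  split : ∀ i j → f i j ≡ (ascending i j * f i j + ascending j i * f i j) + δ i j * f i j
  split i j = begin
    f i j                                                 ≡⟨ ℤₚ.*-identityˡ (f i j) ⟨
    + 1 * f i j                                           ≡⟨ *-congʳ (f i j) (ascending-trichotomy i j) ⟨
    (ascending i j + ascending j i + δ i j) * f i j       ≡⟨ distrib (ascending i j) (ascending j i) (δ i j) (f i j) ⟩
    (ascending i j * f i j + ascending j i * f i j) + δ i j * f i j ∎

sum-δ : ∀ {n} (f : Fin n → ℤ) → HasSum (λ i j → δ i j * f i) (Σℤ f)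
sum-δ f = hasSum (Σ-cong λ i → Σ-δˡ i (λ _ → f i))

-- `expand` states the identity for the product to which the power reduces, leaving no exponent for
-- the ring solver. The same device recurs below.
x²≡ : ∀ x → x * x ≡ x ^ 2
x²≡ = expand
  where
  expand : ∀ x → x * x ≡ x * (x * + 1)
  expand = solve-∀

x³≡ : ∀ x → x * x * x ≡ x ^ 3
x³≡ = expand
  where
  expand : ∀ x → x * x * x ≡ x * (x * (x * + 1))
  expand = solve-∀

x⁴≡ : ∀ x → x * x * x * x ≡ x ^ 4
x⁴≡ = expand
  where
  expand : ∀ x → x * x * x * x ≡ x * (x * (x * (x * + 1)))
  expand = solve-∀

x⁵≡ : ∀ x → x * x * x * x * x ≡ x ^ 5
x⁵≡ = expand
  where
  expand : ∀ x → x * x * x * x * x ≡ x * (x * (x * (x * (x * + 1))))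
  expand = solve-∀

x⁶≡ : ∀ x → x * x * x * x * x * x ≡ x ^ 6
x⁶≡ = expand
  where
  expand : ∀ x → x * x * x * x * x * x ≡ x * (x * (x * (x * (x * (x * + 1)))))
  expand = solve-∀

module Invariants {n} (G : SimpleGraph n) where
  open Walk G

  m : ℤ
  m = numEdges G

  sum-A : ∀ (f : Fin n → Fin n → ℤ) → HasSum (λ i j → A i j * f i j) (Σedges G (λ i j → f i j + f j i))
  sum-A f = revalue value (sum-unordered (λ i j → A i j * f i j))
    where
    value : Σpairs (λ i j → A i j * f i j + A j i * f j i) + Σℤ (λ i → A i i * f i i) ≡ Σedges G (λ i j → f i j + f j i)
    value = trans (cong₂ _+_
        (Σpairs-cong λ i j → trans (+-congˡ (A i j * f i j) (*-congʳ (f j i) (A-sym j i)))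
          (sym (ℤₚ.*-distribˡ-+ (A i j) (f i j) (f j i))))
        (Σ-zero λ i → *-congʳ (f i i) (A-diag i)))
      (ℤₚ.+-identityʳ (Σedges G (λ i j → f i j + f j i)))

  Σedges-cong : ∀ {f g : Fin n → Fin n → ℤ} → (∀ i j → f i j ≡ g i j) → Σedges G f ≡ Σedges G g
  Σedges-cong h = Σpairs-cong λ i j → *-congˡ (A i j) (h i j)

  Σedges-double : ∀ (f : Fin n → Fin n → ℤ) → Σedges G (λ i j → f i j + f i j) ≡ Σedges G f + Σedges G f
  Σedges-double f = trans (Σpairs-cong λ i j → ℤₚ.*-distribˡ-+ (A i j) (f i j) (f i j))
    (Σpairs-+ (λ i j → A i j * f i j) (λ i j → A i j * f i j))

  sum-A-row : ∀ (f : Fin n → ℤ) → HasSum (λ i j → A i j * f i) (Σℤ (λ i → d i * f i))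
  sum-A-row f = hasSum (Σ-cong λ i → Σ-*ʳ (f i) (A i))

  sum-A-col : ∀ (f : Fin n → ℤ) → HasSum (λ i j → A i j * f j) (Σℤ (λ i → d i * f i))
  sum-A-col f = reshape (λ i j → *-congʳ (f j) (A-sym i j)) (transpose (sum-A-row f))

  -- The letters e, a, x, w, w₂, y name the matrix that is summed, as in Profile; the suffix is the
  -- weight, where i and j stand for the degrees of the two vertices and s, s₂ are as in Profile.
  a-1 : HasSum A (m + m)
  a-1 = hasSum (begin
    Σℤ (λ i → Σℤ λ j → A i j)
      ≡⟨ Σ-cong₂ (λ i j → ℤₚ.*-identityʳ (A i j)) ⟨
    Σℤ (λ i → Σℤ λ j → A i j * + 1)
      ≡⟨ total (sum-A (λ _ _ → + 1)) ⟩
    Σedges G (λ _ _ → + 1 + + 1)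
      ≡⟨ Σedges-double (λ _ _ → + 1) ⟩
    m + m ∎)

  M1-2 : Σℤ (λ i → d i * d i) ≡ M1 2 G
  M1-2 = Σ-cong λ i → x²≡ (d i)

  M1-3 : Σℤ (λ i → d i * (d i * d i)) ≡ M1 3 G
  M1-3 = Σ-cong λ i → trans (sym (ℤₚ.*-assoc (d i) (d i) (d i))) (x³≡ (d i))

  M1-4 : Σℤ (λ i → d i * (d i * d i * d i)) ≡ M1 4 G
  M1-4 = Σ-cong λ i → trans (ℤₚ.*-comm (d i) (d i * d i * d i)) (x⁴≡ (d i))

  M1-5 : Σℤ (λ i → d i * (d i * d i * d i * d i)) ≡ M1 5 G
  M1-5 = Σ-cong λ i → trans (ℤₚ.*-comm (d i) (d i * d i * d i * d i)) (x⁵≡ (d i))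

  a-i : HasSum (λ i j → A i j * d i) (M1 2 G)
  a-i = revalue M1-2 (sum-A-row d)

  a-j : HasSum (λ i j → A i j * d j) (M1 2 G)
  a-j = revalue M1-2 (sum-A-col d)

  a-ii : HasSum (λ i j → A i j * (d i * d i)) (M1 3 G)
  a-ii = revalue M1-3 (sum-A-row d²)

  a-jj : HasSum (λ i j → A i j * (d j * d j)) (M1 3 G)
  a-jj = revalue M1-3 (sum-A-col d²)

  a-iii : HasSum (λ i j → A i j * (d i * d i * d i)) (M1 4 G)
  a-iii = revalue M1-4 (sum-A-row (λ i → d i * d i * d i))

  a-jjj : HasSum (λ i j → A i j * (d j * d j * d j)) (M1 4 G)
  a-jjj = revalue M1-4 (sum-A-col (λ i → d i * d i * d i))

  a-iiii : HasSum (λ i j → A i j * (d i * d i * d i * d i)) (M1 5 G)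
  a-iiii = revalue M1-5 (sum-A-row (λ i → d i * d i * d i * d i))

  a-jjjj : HasSum (λ i j → A i j * (d j * d j * d j * d j)) (M1 5 G)
  a-jjjj = revalue M1-5 (sum-A-col (λ i → d i * d i * d i * d i))

  a-ij : HasSum (λ i j → A i j * (d i * d j)) (M2 1 G + M2 1 G)
  a-ij = revalue (trans (Σedges-cong λ i j → lemma (d i) (d j)) (Σedges-double (λ i j → (d i * d j) ^ 1)))
      (sum-A (λ i j → d i * d j))
    where
    lemma : ∀ x y → x * y + y * x ≡ (x * y) * + 1 + (x * y) * + 1
    lemma = solve-∀

  a-iijj : HasSum (λ i j → A i j * (d i * d i * (d j * d j))) (M2 2 G + M2 2 G)
  a-iijj = revalue (trans (Σedges-cong λ i j → lemma (d i) (d j)) (Σedges-double (λ i j → (d i * d j) ^ 2)))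
      (sum-A (λ i j → d i * d i * (d j * d j)))
    where
    lemma : ∀ x y → x * x * (y * y) + y * y * (x * x)
      ≡ (x * y) * ((x * y) * + 1) + (x * y) * ((x * y) * + 1)
    lemma = solve-∀

  a-ijj : HasSum (λ i j → A i j * (d i * (d j * d j))) (alpha 1 2 G)
  a-ijj = revalue (Σedges-cong λ i j → lemma (d i) (d j)) (sum-A (λ i j → d i * (d j * d j)))
    where
    lemma : ∀ x y → x * (y * y) + y * (x * x)
      ≡ (x * + 1) * (y * (y * + 1)) + (x * (x * + 1)) * (y * + 1)
    lemma = solve-∀

  a-iij : HasSum (λ i j → A i j * (d i * d i * d j)) (alpha 1 2 G)
  a-iij = reshape (λ i j → cong₂ _*_ (A-sym i j) (ℤₚ.*-comm (d i * d i) (d j))) (transpose a-ijj)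

  a-ijjj : HasSum (λ i j → A i j * (d i * (d j * d j * d j))) (alpha 1 3 G)
  a-ijjj = revalue (Σedges-cong λ i j → lemma (d i) (d j)) (sum-A (λ i j → d i * (d j * d j * d j)))
    where
    lemma : ∀ x y → x * (y * y * y) + y * (x * x * x)
      ≡ (x * + 1) * (y * (y * (y * + 1))) + (x * (x * (x * + 1))) * (y * + 1)
    lemma = solve-∀

  a-iiij : HasSum (λ i j → A i j * (d i * d i * d i * d j)) (alpha 1 3 G)
  a-iiij = reshape (λ i j → cong₂ _*_ (A-sym i j) (ℤₚ.*-comm (d i * d i * d i) (d j))) (transpose a-ijjj)

  e-i : HasSum (λ i j → δ i j * d i) (m + m)
  e-i = revalue (total a-1) (sum-δ d)

  e-ii : HasSum (λ i j → δ i j * (d i * d i)) (M1 2 G)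
  e-ii = revalue M1-2 (sum-δ d²)

  e-iii : HasSum (λ i j → δ i j * (d i * d i * d i)) (M1 3 G)
  e-iii = revalue (Σ-cong λ i → x³≡ (d i)) (sum-δ (λ i → d i * d i * d i))

  e-iiii : HasSum (λ i j → δ i j * (d i * d i * d i * d i)) (M1 4 G)
  e-iiii = revalue (Σ-cong λ i → x⁴≡ (d i)) (sum-δ (λ i → d i * d i * d i * d i))

  e-iiiii : HasSum (λ i j → δ i j * (d i * d i * d i * d i * d i)) (M1 5 G)
  e-iiiii = revalue (Σ-cong λ i → x⁵≡ (d i)) (sum-δ (λ i → d i * d i * d i * d i * d i))

  e-iiiiii : HasSum (λ i j → δ i j * (d i * d i * d i * d i * d i * d i)) (M1 6 G)
  e-iiiiii = revalue (Σ-cong λ i → x⁶≡ (d i)) (sum-δ (λ i → d i * d i * d i * d i * d i * d i))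

  weighted-S : ∀ (f g : Fin n → ℤ) → Σℤ (λ i → f i * S g i) ≡ Σℤ (λ i → Σℤ λ j → A i j * (f i * g j))
  weighted-S f g = Σ-cong λ i → trans (sym (Σ-*ˡ (f i) (λ j → A i j * g j)))
    (Σ-cong λ j → lemma (f i) (A i j) (g j))
    where
    lemma : ∀ x a y → x * (a * y) ≡ a * (x * y)
    lemma = solve-∀

  sum-dS : Σℤ (λ i → d i * S d i) ≡ M2 1 G + M2 1 G
  sum-dS = trans (weighted-S d d) (total a-ij)

  sum-d²S : Σℤ (λ i → d i * d i * S d i) ≡ alpha 1 2 G
  sum-d²S = trans (weighted-S d² d) (total a-iij)

  sum-dS² : Σℤ (λ i → d i * S d² i) ≡ alpha 1 2 G
  sum-dS² = trans (weighted-S d d²) (total a-ijj)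

  e-s : HasSum (λ i j → δ i j * S d i) (M1 2 G)
  e-s = revalue (total a-j) (sum-δ (S d))

  e-s₂ : HasSum (λ i j → δ i j * S d² i) (M1 3 G)
  e-s₂ = revalue (total a-jj) (sum-δ (S d²))

  e-is : HasSum (λ i j → δ i j * (d i * S d i)) (M2 1 G + M2 1 G)
  e-is = revalue sum-dS (sum-δ (λ i → d i * S d i))

  e-iis : HasSum (λ i j → δ i j * (d i * d i * S d i)) (alpha 1 2 G)
  e-iis = revalue sum-d²S (sum-δ (λ i → d i * d i * S d i))

  e-iiis : HasSum (λ i j → δ i j * (d i * d i * d i * S d i)) (alpha 1 3 G)
  e-iiis = revalue (trans (weighted-S (λ i → d i * d i * d i) d) (total a-iiij)) (sum-δ (λ i → d i * d i * d i * S d i))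

  -- The value of the sum over v of (S d v)². Squaring gives ordered pairs of neighbours of v:
  -- distinct ones yield each P₃ twice, and equal ones yield deg² of each vertex once per neighbour,
  -- hence `M1 3 G`.
  Θ : ℤ
  Θ = Theta2 G + Theta2 G + M1 3 G

  sum-S² : Σℤ (λ v → S d v * S d v) ≡ Θ
  sum-S² = begin
    Σℤ (λ v → S d v * S d v)
      ≡⟨ Σ-cong (λ v → square v) ⟩
    Σℤ (λ v → (Θᵥ v + Θᵥ v) + S d² v)
      ≡⟨ Σ-+ (λ v → Θᵥ v + Θᵥ v) (S d²) ⟩
    Σℤ (λ v → Θᵥ v + Θᵥ v) + Σℤ (S d²)
      ≡⟨ cong₂ _+_ (Σ-+ Θᵥ Θᵥ) (total a-jj) ⟩
    Theta2 G + Theta2 G + M1 3 G ∎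
    where
    g : Fin n → Fin n → Fin n → ℤ
    g v u w = A v u * A v w * (d u * d w)

    Θᵥ : Fin n → ℤ
    Θᵥ v = Σpairs (g v)

    expand : ∀ a x b y → (a * x) * (b * y) ≡ a * b * (x * y)
    expand = solve-∀

    swap-uw : ∀ a b x y → b * a * (y * x) ≡ a * b * (x * y)
    swap-uw = solve-∀

    idem : ∀ b y → b2z b * b2z b * y ≡ b2z b * y
    idem true  y = refl
    idem false y = refl

    square : ∀ v → S d v * S d v ≡ (Θᵥ v + Θᵥ v) + S d² v
    square v = begin
      S d v * S d v
        ≡⟨ Σ-*ʳ (S d v) (λ u → A v u * d u) ⟨
      Σℤ (λ u → (A v u * d u) * S d v)
        ≡⟨ Σ-cong (λ u → trans (sym (Σ-*ˡ (A v u * d u) (λ w → A v w * d w))) (Σ-cong λ w → expand (A v u) (d u) (A v w) (d w))) ⟩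
      Σℤ (λ u → Σℤ λ w → g v u w)
        ≡⟨ total (sum-unordered (g v)) ⟩
      Σpairs (λ u w → g v u w + g v w u) + Σℤ (λ u → g v u u)
        ≡⟨ cong₂ _+_
             (trans (Σpairs-cong λ u w → +-congˡ (g v u w) (swap-uw (A v u) (A v w) (d u) (d w))) (Σpairs-+ (g v) (g v)))
             (Σ-cong λ u → idem (adj G v u) (d u * d u)) ⟩
      (Θᵥ v + Θᵥ v) + S d² v ∎

  e-ss : HasSum (λ i j → δ i j * (S d i * S d i)) Θ
  e-ss = revalue sum-S² (sum-δ (λ i → S d i * S d i))

  -- The bilinear form of A diag(w) A at f and g, summed over the middle vertex last. The sums of
  -- A², A D A and A D² A below are instances.
  sum-W : ∀ (w f g : Fin n → ℤ) → HasSum (λ i j → W w i j * (f i * g j)) (Σℤ (λ k → w k * (S f k * S g k)))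
  sum-W w f g = hasSum (begin
    Σℤ (λ i → Σℤ λ j → W w i j * (f i * g j))
      ≡⟨ Σ-cong₂ (λ i j → trans (sym (Σ-*ʳ (f i * g j) (λ k → A i k * (w k * A k j))))
           (Σ-cong λ k → trans (cong (λ z → z * (w k * A k j) * (f i * g j)) (A-sym i k)) (regroup (A k i) (w k) (A k j) (f i) (g j)))) ⟩
    Σℤ (λ i → Σℤ λ j → Σℤ λ k → w k * ((A k i * f i) * (A k j * g j)))
      ≡⟨ Σ-cong (λ i → Σ-swap (λ j k → w k * ((A k i * f i) * (A k j * g j)))) ⟩
    Σℤ (λ i → Σℤ λ k → Σℤ λ j → w k * ((A k i * f i) * (A k j * g j)))
      ≡⟨ Σ-swap (λ i k → Σℤ λ j → w k * ((A k i * f i) * (A k j * g j))) ⟩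
    Σℤ (λ k → Σℤ λ i → Σℤ λ j → w k * ((A k i * f i) * (A k j * g j)))
      ≡⟨ Σ-cong (λ k → trans
           (Σ-cong λ i → trans (Σ-*ˡ (w k) (λ j → (A k i * f i) * (A k j * g j))) (*-congˡ (w k) (Σ-*ˡ (A k i * f i) (λ j → A k j * g j))))
           (trans (Σ-*ˡ (w k) (λ i → (A k i * f i) * S g k)) (*-congˡ (w k) (Σ-*ʳ (S g k) (λ i → A k i * f i))))) ⟩
    Σℤ (λ k → w k * (S f k * S g k)) ∎)
    where
    regroup : ∀ a w b x y → a * (w * b) * (x * y) ≡ w * ((a * x) * (b * y))
    regroup = solve-∀

  insert-1ʳ : ∀ x y → x * y ≡ x * (y * + 1)
  insert-1ʳ = solve-∀

  insert-1ˡ : ∀ x y → x * y ≡ x * (+ 1 * y)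
  insert-1ˡ = solve-∀

  insert-11 : ∀ x → x ≡ x * (+ 1 * + 1)
  insert-11 = solve-∀

  x-1 : HasSum A² (M1 2 G)
  x-1 = reshape (λ i j → insert-11 (A² i j)) (revalue
    (trans (Σ-cong λ k → trans (cong₂ (λ x y → + 1 * (x * y)) (S-1 k) (S-1 k)) (ℤₚ.*-identityˡ (d k * d k))) M1-2)
    (sum-W 𝟙 𝟙 𝟙))

  x-i : HasSum (λ i j → A² i j * d i) (M2 1 G + M2 1 G)
  x-i = reshape (λ i j → insert-1ʳ (A² i j) (d i)) (revalue
    (trans (Σ-cong λ k → trans (cong (λ y → + 1 * (S d k * y)) (S-1 k)) (lemma (S d k) (d k))) sum-dS)
    (sum-W 𝟙 d 𝟙))
    where
    lemma : ∀ x y → + 1 * (x * y) ≡ y * x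
    lemma = solve-∀

  x-j : HasSum (λ i j → A² i j * d j) (M2 1 G + M2 1 G)
  x-j = reshape (λ i j → insert-1ˡ (A² i j) (d j)) (revalue
    (trans (Σ-cong λ k → trans (cong (λ y → + 1 * (y * S d k)) (S-1 k)) (ℤₚ.*-identityˡ (d k * S d k))) sum-dS)
    (sum-W 𝟙 𝟙 d))

  x-ii : HasSum (λ i j → A² i j * (d i * d i)) (alpha 1 2 G)
  x-ii = reshape (λ i j → insert-1ʳ (A² i j) (d i * d i)) (revalue
    (trans (Σ-cong λ k → trans (cong (λ y → + 1 * (S d² k * y)) (S-1 k)) (lemma (S d² k) (d k))) sum-dS²)
    (sum-W 𝟙 d² 𝟙))
    where
    lemma : ∀ x y → + 1 * (x * y) ≡ y * x
    lemma = solve-∀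

  x-jj : HasSum (λ i j → A² i j * (d j * d j)) (alpha 1 2 G)
  x-jj = reshape (λ i j → insert-1ˡ (A² i j) (d j * d j)) (revalue
    (trans (Σ-cong λ k → trans (cong (λ y → + 1 * (y * S d² k)) (S-1 k)) (ℤₚ.*-identityˡ (d k * S d² k))) sum-dS²)
    (sum-W 𝟙 𝟙 d²))

  x-ij : HasSum (λ i j → A² i j * (d i * d j)) Θ
  x-ij = revalue (trans (Σ-cong λ k → ℤₚ.*-identityˡ (S d k * S d k)) sum-S²) (sum-W 𝟙 d d)

  w-1 : HasSum (W d) (M1 3 G)
  w-1 = reshape (λ i j → insert-11 (W d i j)) (revalue
    (trans (Σ-cong λ k → cong₂ (λ x y → d k * (x * y)) (S-1 k) (S-1 k)) M1-3)
    (sum-W d 𝟙 𝟙))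

  w-i : HasSum (λ i j → W d i j * d i) (alpha 1 2 G)
  w-i = reshape (λ i j → insert-1ʳ (W d i j) (d i)) (revalue
    (trans (Σ-cong λ k → trans (cong (λ y → d k * (S d k * y)) (S-1 k)) (lemma (S d k) (d k))) sum-d²S)
    (sum-W d d 𝟙))
    where
    lemma : ∀ x y → y * (x * y) ≡ y * y * x
    lemma = solve-∀

  w-j : HasSum (λ i j → W d i j * d j) (alpha 1 2 G)
  w-j = reshape (λ i j → insert-1ˡ (W d i j) (d j)) (revalue
    (trans (Σ-cong λ k → trans (cong (λ y → d k * (y * S d k)) (S-1 k)) (sym (ℤₚ.*-assoc (d k) (d k) (S d k)))) sum-d²S)
    (sum-W d 𝟙 d))

  w₂-1 : HasSum (W d²) (M1 4 G)
  w₂-1 = reshape (λ i j → insert-11 (W d² i j)) (revalue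
    (trans (Σ-cong λ k → trans (cong₂ (λ x y → d² k * (x * y)) (S-1 k) (S-1 k)) (lemma (d k))) M1-4)
    (sum-W d² 𝟙 𝟙))
    where
    lemma : ∀ x → x * x * (x * x) ≡ x * (x * x * x)
    lemma = solve-∀

  y-1 : HasSum A³ (M2 1 G + M2 1 G)
  y-1 = hasSum (begin
    Σℤ (λ i → Σℤ λ j → A³ i j)
      ≡⟨ Σ-cong (λ i → Σ-swap (λ j k → A i k * A² k j)) ⟩
    Σℤ (λ i → Σℤ λ k → Σℤ λ j → A i k * A² k j)
      ≡⟨ Σ-swap (λ i k → Σℤ λ j → A i k * A² k j) ⟩
    Σℤ (λ k → Σℤ λ i → Σℤ λ j → A i k * A² k j)
      ≡⟨ Σ-cong (λ k → Σ-swap (λ i j → A i k * A² k j)) ⟩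
    Σℤ (λ k → Σℤ λ j → Σℤ λ i → A i k * A² k j)
      ≡⟨ Σ-cong₂ column ⟩
    Σℤ (λ k → Σℤ λ j → A² k j * d k)
      ≡⟨ total x-i ⟩
    M2 1 G + M2 1 G ∎)
    where
    column : ∀ k j → Σℤ (λ i → A i k * A² k j) ≡ A² k j * d k
    column k j = begin
      Σℤ (λ i → A i k * A² k j)  ≡⟨ Σ-*ʳ (A² k j) (λ i → A i k) ⟩
      Σℤ (λ i → A i k) * A² k j  ≡⟨ cong (λ z → z * A² k j) (Σ-cong λ i → A-sym i k) ⟩
      d k * A² k j               ≡⟨ ℤₚ.*-comm (d k) (A² k j) ⟩
      A² k j * d k ∎

-- Traces of powers of the Laplacian

module LaplacianPowers {n} (G : SimpleGraph n) where
  open Walk G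
  open Invariants G
  open CharPoly (laplacian G)

  laplacian-sym : ∀ i j → laplacian G i j ≡ laplacian G j i
  laplacian-sym i j = trans (laplacian-δA i j) (trans (cong₂ _-_ δd (A-sym i j)) (sym (laplacian-δA j i)))
    where
    δd : δ i j * d i ≡ δ j i * d j
    δd with i ≟ j
    ... | yes refl = cong (_* d i) (sym (δ-refl i))
    ... | no i≢j   = cong (_* d j) (sym (δ-≢ (i≢j ∘ sym)))

  pow¹ : ∀ i j → pow 1 i j ≡ δ i j * d i - A i j
  pow¹ i j = trans (pow-1 i j) (laplacian-δA i j)

  laplacian-apply : ∀ i (f : Fin n → ℤ) → Σℤ (λ k → pow 1 i k * f k) ≡ d i * f i - Σℤ (λ k → A i k * f k)
  laplacian-apply i f = begin
    Σℤ (λ k → pow 1 i k * f k)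
      ≡⟨ Σ-cong (λ k → trans (*-congʳ (f k) (pow¹ i k)) (lemma (δ i k) (d i) (A i k) (f k))) ⟩
    Σℤ (λ k → δ i k * (d i * f k) - A i k * f k)
      ≡⟨ Σ-- (λ k → δ i k * (d i * f k)) (λ k → A i k * f k) ⟩
    Σℤ (λ k → δ i k * (d i * f k)) - Σℤ (λ k → A i k * f k)
      ≡⟨ cong (_- Σℤ (λ k → A i k * f k)) (Σ-δˡ i (λ k → d i * f k)) ⟩
    d i * f i - Σℤ (λ k → A i k * f k) ∎
    where
    lemma : ∀ e x a y → (e * x - a) * y ≡ e * (x * y) - a * y
    lemma = solve-∀

  pow² : ∀ i j → pow 2 i j ≡ δ i j * (d i * d i) - A i j * (d i + d j) + A² i j
  pow² i j = begin
    pow 2 i j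
      ≡⟨ pow-+ 1 1 i j ⟩
    Σℤ (λ k → pow 1 i k * pow 1 k j)
      ≡⟨ laplacian-apply i (λ k → pow 1 k j) ⟩
    d i * pow 1 i j - Σℤ (λ k → A i k * pow 1 k j)
      ≡⟨ cong₂ (λ x y → d i * x - y) (pow¹ i j) neighbours ⟩
    d i * (δ i j * d i - A i j) - (A i j * d j - A² i j)
      ≡⟨ collect (d i) (d j) (δ i j) (A i j) (A² i j) ⟩
    δ i j * (d i * d i) - A i j * (d i + d j) + A² i j ∎
    where
    -- The factor `+ 1` is the weight `𝟙` hidden in `A²`.
    expand : ∀ a e x b → a * (e * x - b) ≡ (a * x) * e - a * (+ 1 * b)
    expand = solve-∀

    collect : ∀ di dj e a x → di * (e * di - a) - (a * dj - x) ≡ e * (di * di) - a * (di + dj) + x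
    collect = solve-∀

    neighbours : Σℤ (λ k → A i k * pow 1 k j) ≡ A i j * d j - A² i j
    neighbours = begin
      Σℤ (λ k → A i k * pow 1 k j)
        ≡⟨ Σ-cong (λ k → trans (*-congˡ (A i k) (pow¹ k j)) (expand (A i k) (δ k j) (d k) (A k j))) ⟩
      Σℤ (λ k → (A i k * d k) * δ k j - A i k * (+ 1 * A k j))
        ≡⟨ Σ-- (λ k → (A i k * d k) * δ k j) (λ k → A i k * (+ 1 * A k j)) ⟩
      Σℤ (λ k → (A i k * d k) * δ k j) - A² i j
        ≡⟨ cong (_- A² i j) (Σ-δʳ j (λ k → A i k * d k)) ⟩
      A i j * d j - A² i j ∎

  -- Entries of D³ - (D²A + DAD + AD²) + (DA² + ADA + A²D) - A³.
  pow³ : ∀ i j → pow 3 i j ≡ δ i j * (d i * d i * d i) - A i j * (d i * d i + d i * d j + d j * d j)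
    + A² i j * (d i + d j) + W d i j - A³ i j
  pow³ i j = begin
    pow 3 i j
      ≡⟨ pow-+ 1 2 i j ⟩
    Σℤ (λ k → pow 1 i k * pow 2 k j)
      ≡⟨ laplacian-apply i (λ k → pow 2 k j) ⟩
    d i * pow 2 i j - Σℤ (λ k → A i k * pow 2 k j)
      ≡⟨ cong₂ (λ x y → d i * x - y) (pow² i j) neighbours ⟩
    d i * (δ i j * (d i * d i) - A i j * (d i + d j) + A² i j)
      - (A i j * (d j * d j) - (W d i j + A² i j * d j) + A³ i j)
      ≡⟨ collect (d i) (d j) (δ i j) (A i j) (A² i j) (W d i j) (A³ i j) ⟩
    δ i j * (d i * d i * d i) - A i j * (d i * d i + d i * d j + d j * d j)
      + A² i j * (d i + d j) + W d i j - A³ i j ∎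
    where
    expand : ∀ a e x y b z → a * (e * (x * x) - b * (x + y) + z)
      ≡ (a * (x * x)) * e - (a * (x * b) + a * (+ 1 * b) * y) + a * z
    expand = solve-∀

    collect : ∀ di dj e a x w y →
      di * (e * (di * di) - a * (di + dj) + x) - (a * (dj * dj) - (w + x * dj) + y)
      ≡ e * (di * di * di) - a * (di * di + di * dj + dj * dj) + x * (di + dj) + w - y
    collect = solve-∀

    neighbours : Σℤ (λ k → A i k * pow 2 k j) ≡ A i j * (d j * d j) - (W d i j + A² i j * d j) + A³ i j
    neighbours = begin
      Σℤ (λ k → A i k * pow 2 k j)
        ≡⟨ Σ-cong (λ k → trans (*-congˡ (A i k) (pow² k j)) (expand (A i k) (δ k j) (d k) (d j) (A k j) (A² k j))) ⟩
      Σℤ (λ k → p k - (q k + r k) + s k)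
        ≡⟨ Σ-+ (λ k → p k - (q k + r k)) s ⟩
      Σℤ (λ k → p k - (q k + r k)) + A³ i j
        ≡⟨ cong (_+ A³ i j) (Σ-- p (λ k → q k + r k)) ⟩
      Σℤ p - Σℤ (λ k → q k + r k) + A³ i j
        ≡⟨ cong₂ (λ x y → x - y + A³ i j) (Σ-δʳ j (λ k → A i k * (d k * d k)))
             (trans (Σ-+ q r) (+-congˡ (W d i j) (Σ-*ʳ (d j) (λ k → A i k * (+ 1 * A k j))))) ⟩
      A i j * (d j * d j) - (W d i j + A² i j * d j) + A³ i j ∎
      where
      p q r s : Fin n → ℤ
      p k = (A i k * (d k * d k)) * δ k j
      q k = A i k * (d k * A k j)
      r k = A i k * (+ 1 * A k j) * d j
      s k = A i k * A² k j

  trace-1 : trace 1 ≡ + 2 * m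
  trace-1 = begin
    Σℤ (λ i → pow 1 i i)
      ≡⟨ Σ-cong (λ i → trans (pow¹ i i) (trans (cong₂ (λ x y → x * d i - y) (δ-refl i) (A-diag i)) (lemma (d i)))) ⟩
    Σℤ d
      ≡⟨ total a-1 ⟩
    m + m
      ≡⟨ double m ⟩
    + 2 * m ∎
    where
    lemma : ∀ x → + 1 * x - + 0 ≡ x
    lemma = solve-∀
    double : ∀ x → x + x ≡ + 2 * x
    double = solve-∀

  module _ (forest : IsForest G) where
    open Forest forest

    trace-2 : trace 2 ≡ M1 2 G + + 2 * m
    trace-2 = trans (trace-+ laplacian-sym 1 1) (trans
      (Σ-cong₂ λ i j → trans (cong₂ _*_ (pow¹ i j) (pow¹ i j)) (profile-L¹L¹ (profile i j)))
      (trans (total (e-ii ⊞ a-1)) (collect (M1 2 G) m)))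
      where
      collect : ∀ a m → a + (m + m) ≡ a + + 2 * m
      collect = solve-∀

    trace-3 : trace 3 ≡ M1 3 G + + 3 * M1 2 G
    trace-3 = trans (trace-+ laplacian-sym 1 2) (trans
      (Σ-cong₂ λ i j → trans (cong₂ _*_ (pow¹ i j) (pow² i j)) (profile-L¹L² (profile i j)))
      (trans (total (e-iii ⊞ e-ii ⊞ a-i ⊞ a-j)) (collect (M1 2 G) (M1 3 G))))
      where
      collect : ∀ a b → b + (a + (a + a)) ≡ b + + 3 * a
      collect = solve-∀

    trace-4 : trace 4 ≡ M1 4 G + + 4 * M1 3 G + + 2 * M1 2 G + + 4 * M2 1 G - + 2 * m
    trace-4 = trans (trace-+ laplacian-sym 2 2) (trans
      (Σ-cong₂ λ i j → trans (cong₂ _*_ (pow² i j) (pow² i j)) (profile-L²L² (profile i j)))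
      -- The summands follow the right-hand side of `profile-L²L²` term by term.
      (trans (total (e-iiii ⊞ + 2 ⊡ e-iii ⊞ e-ii ⊞ - (+ 1) ⊡ e-i ⊞ a-ii ⊞ a-jj ⊞ + 2 ⊡ a-ij ⊞ x-1))
        (collect m (M1 2 G) (M1 3 G) (M1 4 G) (M2 1 G))))
      where
      collect : ∀ m a b c q →
        c + (+ 2 * b + (a + (- (+ 1) * (m + m) + (b + (b + (+ 2 * (q + q) + a))))))
        ≡ c + + 4 * b + + 2 * a + + 4 * q - + 2 * m
      collect = solve-∀

    trace-5 : trace 5 ≡ M1 5 G + + 5 * M1 4 G + + 5 * M1 3 G - + 5 * M1 2 G + + 5 * alpha 1 2 G + + 10 * M2 1 G
    trace-5 = trans (trace-+ laplacian-sym 2 3) (trans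
      (Σ-cong₂ λ i j → trans (cong₂ _*_ (pow² i j) (pow³ i j)) (profile-L²L³ (profile i j)))
      (trans (total (e-iiiii ⊞ + 3 ⊡ e-iiii ⊞ + 2 ⊡ e-iii ⊞ - (+ 2) ⊡ e-ii ⊞ e-iis ⊞ e-is ⊞ - (+ 1) ⊡ e-s
          ⊞ a-iii ⊞ a-jjj ⊞ + 2 ⊡ a-iij ⊞ + 2 ⊡ a-ijj ⊞ a-ii ⊞ a-jj ⊞ + 2 ⊡ a-ij ⊞ - (+ 1) ⊡ a-i ⊞ - (+ 1) ⊡ a-j
          ⊞ x-i ⊞ x-j ⊞ w-1))
        (collect (M1 2 G) (M1 3 G) (M1 4 G) (M1 5 G) (M2 1 G) (alpha 1 2 G))))
      where
      collect : ∀ a b c f q r →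
        f + (+ 3 * c + (+ 2 * b + (- (+ 2) * a + (r + ((q + q) + (- (+ 1) * a
          + (c + (c + (+ 2 * r + (+ 2 * r + (b + (b + (+ 2 * (q + q) + (- (+ 1) * a + (- (+ 1) * a
          + ((q + q) + ((q + q) + b)))))))))))))))))
        ≡ f + + 5 * c + + 5 * b - + 5 * a + + 5 * r + + 10 * q
      collect = solve-∀

    trace-6 : trace 6 ≡ M1 6 G + + 6 * M1 5 G + + 9 * M1 4 G - + 4 * M1 3 G - + 6 * M1 2 G + + 4 * m
      + + 6 * alpha 1 3 G + + 18 * alpha 1 2 G + + 6 * M2 2 G - + 6 * M2 1 G + + 6 * Theta2 G
    trace-6 = trans (trace-+ laplacian-sym 3 3) (trans
      (Σ-cong₂ λ i j → trans (cong₂ _*_ (pow³ i j) (pow³ i j)) (profile-L³L³ (profile i j)))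
      (trans (total (e-iiiiii ⊞ + 4 ⊡ e-iiiii ⊞ + 4 ⊡ e-iiii ⊞ - (+ 4) ⊡ e-iii ⊞ + 2 ⊡ e-iiis ⊞ + 4 ⊡ e-iis
          ⊞ - (+ 4) ⊡ e-is ⊞ e-ss ⊞ - (+ 1) ⊡ e-s₂
          ⊞ a-iiii ⊞ a-jjjj ⊞ + 2 ⊡ a-iiij ⊞ + 2 ⊡ a-ijjj ⊞ + 3 ⊡ a-iijj ⊞ + 2 ⊡ a-iii ⊞ + 2 ⊡ a-jjj
          ⊞ + 4 ⊡ a-iij ⊞ + 4 ⊡ a-ijj ⊞ - (+ 1) ⊡ a-ii ⊞ - (+ 1) ⊡ a-jj ⊞ - (+ 3) ⊡ a-i ⊞ - (+ 3) ⊡ a-j ⊞ + 2 ⊡ a-1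
          ⊞ x-ii ⊞ x-jj ⊞ + 2 ⊡ x-ij ⊞ + 2 ⊡ w-i ⊞ + 2 ⊡ w-j ⊞ w₂-1 ⊞ y-1))
        (collect m (M1 2 G) (M1 3 G) (M1 4 G) (M1 5 G) (M1 6 G) (M2 1 G) (M2 2 G) (alpha 1 2 G) (alpha 1 3 G) (Theta2 G))))
      where
      collect : ∀ m a b c f g q q₂ r t θ →
        g + (+ 4 * f + (+ 4 * c + (- (+ 4) * b + (+ 2 * t + (+ 4 * r + (- (+ 4) * (q + q) + ((θ + θ + b) + (- (+ 1) * b
          + (f + (f + (+ 2 * t + (+ 2 * t + (+ 3 * (q₂ + q₂) + (+ 2 * c + (+ 2 * c + (+ 4 * r + (+ 4 * r
          + (- (+ 1) * b + (- (+ 1) * b + (- (+ 3) * a + (- (+ 3) * a + (+ 2 * (m + m)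
          + (r + (r + (+ 2 * (θ + θ + b) + (+ 2 * r + (+ 2 * r + (c + (q + q)))))))))))))))))))))))))))))
        ≡ g + + 6 * f + + 9 * c - + 4 * b - + 6 * a + + 4 * m
          + + 6 * t + + 18 * r + + 6 * q₂ - + 6 * q + + 6 * θ
      collect = solve-∀

-- Substitution of the traces and conclusion

-- The invariants become variables, so that the solver meets eleven atoms instead of sums: a, b, c,
-- f, g stand for `M1` with exponents 2 to 6, q and q₂ for `M2`, r and t for `alpha`.
newton-invariants : ∀ {p₁ p₂ p₃ p₄ p₅ p₆} m a b c f g q q₂ r t θ →
  p₁ ≡ + 2 * m →
  p₂ ≡ a + + 2 * m →
  p₃ ≡ b + + 3 * a →
  p₄ ≡ c + + 4 * b + + 2 * a + + 4 * q - + 2 * m →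
  p₅ ≡ f + + 5 * c + + 5 * b - + 5 * a + + 5 * r + + 10 * q →
  p₆ ≡ g + + 6 * f + + 9 * c - + 4 * b - + 6 * a + + 4 * m
    + + 6 * t + + 18 * r + + 6 * q₂ - + 6 * q + + 6 * θ →
  p₁ * p₁ * p₁ * p₁ * p₁ * p₁ - + 15 * (p₁ * p₁ * p₁ * p₁ * p₂) + + 40 * (p₁ * p₁ * p₁ * p₃)
  + + 45 * (p₁ * p₁ * p₂ * p₂) - + 90 * (p₁ * p₁ * p₄) - + 120 * (p₁ * p₂ * p₃) + + 144 * (p₁ * p₅)
  - + 15 * (p₂ * p₂ * p₂) + + 90 * (p₂ * p₄) + + 40 * (p₃ * p₃) - + 120 * p₆
  ≡ + 64 * m ^ 6 - + 480 * m ^ 5 + + 720 * m ^ 4 + + 600 * m ^ 3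
    - + 360 * m ^ 2 - + 480 * m - + 720 * f
    - + 2160 * r - + 720 * t
    + + 540 * a ^ 2 - + 2340 * m ^ 2 * a
    + + 2160 * m * b - + 1080 * c + + 720 * q
    - + 240 * a * b * m - + 120 * g - + 720 * q₂
    + + 600 * a * b + + 1680 * a * m ^ 3
    - + 810 * a ^ 2 * m - + 1920 * b * m ^ 2
    + + 1620 * c * m + + 3600 * q * m - + 720 * θ
    - + 1260 * m * a + + 720 * a + + 480 * b
    - + 240 * m ^ 4 * a + + 320 * m ^ 3 * b
    + + 360 * a * q + + 90 * a * c
    + + 180 * a ^ 2 * m ^ 2 - + 360 * c * m ^ 2
    - + 1440 * q * m ^ 2 + + 288 * f * m
    + + 1440 * r * m + + 40 * b ^ 2
    - + 15 * a ^ 3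
newton-invariants m a b c f g q q₂ r t θ refl refl refl refl refl refl = expand m a b c f g q q₂ r t θ
  where
  expand : ∀ m a b c f g q q₂ r t θ →
    let p₁ = + 2 * m
        p₂ = a + + 2 * m
        p₃ = b + + 3 * a
        p₄ = c + + 4 * b + + 2 * a + + 4 * q - + 2 * m
        p₅ = f + + 5 * c + + 5 * b - + 5 * a + + 5 * r + + 10 * q
        p₆ = g + + 6 * f + + 9 * c - + 4 * b - + 6 * a + + 4 * m
             + + 6 * t + + 18 * r + + 6 * q₂ - + 6 * q + + 6 * θ
    in p₁ * p₁ * p₁ * p₁ * p₁ * p₁ - + 15 * (p₁ * p₁ * p₁ * p₁ * p₂) + + 40 * (p₁ * p₁ * p₁ * p₃)
       + + 45 * (p₁ * p₁ * p₂ * p₂) - + 90 * (p₁ * p₁ * p₄) - + 120 * (p₁ * p₂ * p₃) + + 144 * (p₁ * p₅)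
       - + 15 * (p₂ * p₂ * p₂) + + 90 * (p₂ * p₄) + + 40 * (p₃ * p₃) - + 120 * p₆
    ≡ + 64 * (m * (m * (m * (m * (m * (m * + 1)))))) - + 480 * (m * (m * (m * (m * (m * + 1)))))
      + + 720 * (m * (m * (m * (m * + 1)))) + + 600 * (m * (m * (m * + 1)))
      - + 360 * (m * (m * + 1)) - + 480 * m - + 720 * f
      - + 2160 * r - + 720 * t
      + + 540 * (a * (a * + 1)) - + 2340 * (m * (m * + 1)) * a
      + + 2160 * m * b - + 1080 * c + + 720 * q
      - + 240 * a * b * m - + 120 * g - + 720 * q₂
      + + 600 * a * b + + 1680 * a * (m * (m * (m * + 1)))
      - + 810 * (a * (a * + 1)) * m - + 1920 * b * (m * (m * + 1))
      + + 1620 * c * m + + 3600 * q * m - + 720 * θ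
      - + 1260 * m * a + + 720 * a + + 480 * b
      - + 240 * (m * (m * (m * (m * + 1)))) * a + + 320 * (m * (m * (m * + 1))) * b
      + + 360 * a * q + + 90 * a * c
      + + 180 * (a * (a * + 1)) * (m * (m * + 1)) - + 360 * c * (m * (m * + 1))
      - + 1440 * q * (m * (m * + 1)) + + 288 * f * m
      + + 1440 * r * m + + 40 * (b * (b * + 1))
      - + 15 * (a * (a * (a * + 1)))
  expand = solve-∀

theorem2p27 : (n : ℕ) → (G : SimpleGraph n) → IsForest G → 6 ≤ n →
  let m = numEdges G in
  + 720 * lapCoeff G (n ∸ 6)
    ≡ + 64 * m ^ 6 - + 480 * m ^ 5 + + 720 * m ^ 4 + + 600 * m ^ 3
      - + 360 * m ^ 2 - + 480 * m - + 720 * M1 5 G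
      - + 2160 * alpha 1 2 G - + 720 * alpha 1 3 G
      + + 540 * (M1 2 G) ^ 2 - + 2340 * m ^ 2 * M1 2 G
      + + 2160 * m * M1 3 G - + 1080 * M1 4 G + + 720 * M2 1 G
      - + 240 * M1 2 G * M1 3 G * m - + 120 * M1 6 G - + 720 * M2 2 G
      + + 600 * M1 2 G * M1 3 G + + 1680 * M1 2 G * m ^ 3
      - + 810 * (M1 2 G) ^ 2 * m - + 1920 * M1 3 G * m ^ 2
      + + 1620 * M1 4 G * m + + 3600 * M2 1 G * m - + 720 * Theta2 G
      - + 1260 * m * M1 2 G + + 720 * M1 2 G + + 480 * M1 3 G
      - + 240 * m ^ 4 * M1 2 G + + 320 * m ^ 3 * M1 3 G
      + + 360 * M1 2 G * M2 1 G + + 90 * M1 2 G * M1 4 G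
      + + 180 * (M1 2 G) ^ 2 * m ^ 2 - + 360 * M1 4 G * m ^ 2
      - + 1440 * M2 1 G * m ^ 2 + + 288 * M1 5 G * m
      + + 1440 * alpha 1 2 G * m + + 40 * (M1 3 G) ^ 2
      - + 15 * (M1 2 G) ^ 3
theorem2p27 n G forest 6≤n = begin
  + 720 * lapCoeff G (n ∸ 6)
    ≡⟨ *-congˡ (+ 720) (trans (lapCoeff-reversal G 6 6≤n) (ℤₚ.*-identityˡ (c 6))) ⟩
  + 720 * c 6
    ≡⟨ newton-elimination (trace 1) (trace 2) (trace 3) (trace 4) (trace 5) (trace 6) (c 1) (c 2) (c 3) (c 4) (c 5) (c 6)
         -- In `newton k` the recursion is unrolled until it reaches the constant coefficient of
         -- `T (suc k)`, which is the trace p_{k+1}.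
         (newton 0 (T-zero 1))
         (newton 1 (T-suc 1 0 (T-zero 2)))
         (newton 2 (T-suc 1 1 (T-suc 2 0 (T-zero 3))))
         (newton 3 (T-suc 1 2 (T-suc 2 1 (T-suc 3 0 (T-zero 4)))))
         (newton 4 (T-suc 1 3 (T-suc 2 2 (T-suc 3 1 (T-suc 4 0 (T-zero 5))))))
         (newton 5 (T-suc 1 4 (T-suc 2 3 (T-suc 3 2 (T-suc 4 1 (T-suc 5 0 (T-zero 6))))))) ⟩
  _
    ≡⟨ newton-invariants (numEdges G) (M1 2 G) (M1 3 G) (M1 4 G) (M1 5 G) (M1 6 G)
         (M2 1 G) (M2 2 G) (alpha 1 2 G) (alpha 1 3 G) (Theta2 G)
         trace-1 (trace-2 forest) (trace-3 forest) (trace-4 forest) (trace-5 forest) (trace-6 forest) ⟩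
  _ ∎
  where
  open CharPoly (laplacian G)
  open LaplacianPowers G
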